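{- Let $(\mathcal{S}^x,H)$ be a finite thick STGQ of order $(s,t)$ satisfying property (*), with $s\neq t$ if $s$ is even. Suppose that for every affine line $L$ the stabilizer $H_L$ is elementary abelian. Then for every affine line $L$, $H_L$ contains at least $s/t$ elements which fix every line through the point $\mathrm{proj}_Lx$, i.e. at least $s/t$ root-elations with i-root $(x,\,x\,\mathrm{proj}_Lx,\,\mathrm{proj}_Lx)$.
   Context: A finite GQ of order $(s,t)$: every line has $s+1$ points, every point lies on $t+1$ lines, and for each point $p$ and line $L$ not through $p$ exactly one point of $L$ is collinear with $p$; thick means $s,t\ge2$. An EGQ $(\mathcal{S}^x,H)$: $H\le\mathrm{Aut}(\mathcal{S})$ fixes every line through $x$ and acts sharply transitively on the points not collinear with $x$. A symmetry with center $x$ fixes every point collinear with $x$; an STGQ is an EGQ of order $(s,t)$ whose elation group contains a group of $t$ symmetries with center $x$. Affine lines are lines not through $x$; for such $L$, $\mathrm{proj}_Lx$ is the unique point of $L$ collinear with $x$. Property (*): whenever an element of $H$ fixes a point $y\ne x$ collinear with $x$, it fixes every point of $xy$. -}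

module Defs where

open import Data.Nat using (ℕ; zero; suc; _+_; _*_; _≤_)
open import Data.Nat.Primality using (Prime)
open import Data.Fin using (Fin)
open import Data.Bool using (Bool; true; false)
open import Data.Product using (Σ; ∃; _×_; _,_)
open import Relation.Binary.PropositionalEquality using (_≡_; _≢_)
open import Relation.Nullary using (¬_)

countF : ∀ {n} → (Fin n → Bool) → ℕ
countF {zero}  f = 0
countF {suc n} f with f Fin.zero
... | true  = suc (countF (λ i → f (Fin.suc i)))
... | false = countF (λ i → f (Fin.suc i))

record IncStr : Set where
  field
    np  : ℕ
    nl  : ℕ
    inc : Fin np → Fin nl → Bool

module _ (S : IncStr) where
  open IncStr S

  Point : Set
  Point = Fin np

  Line : Set
  Line = Fin nl

  _I_ : Point → Line → Set
  p I L = inc p L ≡ true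

  -- collinearity (a point is collinear with itself as soon as it lies on a line)
  Collinear : Point → Point → Set
  Collinear p q = Σ Line λ L → p I L × q I L

  -- generalized quadrangle of order (s,t) (Payne–Thas definition)
  record IsGQ (s t : ℕ) : Set where
    field
      linePts   : ∀ L → countF (λ p → inc p L) ≡ suc s
      ptLines   : ∀ p → countF (λ L → inc p L) ≡ suc t
      twoPts    : ∀ p q L M → p ≢ q → p I L → q I L → p I M → q I M → L ≡ M
      twoLines  : ∀ p q L M → L ≢ M → p I L → q I L → p I M → q I M → p ≡ q
      gqAxiom   : ∀ p L → ¬ (p I L) →
                    Σ Point λ q → q I L × Collinear p q ×
                      (∀ q′ → q′ I L → Collinear p q′ → q′ ≡ q)

  Thick : ℕ → ℕ → Set
  Thick s t = 2 ≤ s × 2 ≤ t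

  record Aut : Set where
    field
      pt     : Point → Point
      ln     : Line → Line
      ptInv  : Point → Point
      lnInv  : Line → Line
      ptInvˡ : ∀ p → ptInv (pt p) ≡ p
      ptInvʳ : ∀ p → pt (ptInv p) ≡ p
      lnInvˡ : ∀ L → lnInv (ln L) ≡ L
      lnInvʳ : ∀ L → ln (lnInv L) ≡ L
      presI  : ∀ p L → inc (pt p) (ln L) ≡ inc p L
  open Aut public

  _≈A_ : Aut → Aut → Set
  g ≈A h = (∀ p → pt g p ≡ pt h p) × (∀ L → ln g L ≡ ln h L)

  idA : Aut
  idA = record { pt = λ p → p ; ln = λ L → L ; ptInv = λ p → p ; lnInv = λ L → L
               ; ptInvˡ = λ _ → Relation.Binary.PropositionalEquality.refl
               ; ptInvʳ = λ _ → Relation.Binary.PropositionalEquality.refl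
               ; lnInvˡ = λ _ → Relation.Binary.PropositionalEquality.refl
               ; lnInvʳ = λ _ → Relation.Binary.PropositionalEquality.refl
               ; presI = λ _ _ → Relation.Binary.PropositionalEquality.refl }

  _∘A_ : Aut → Aut → Aut
  g ∘A h = record
    { pt = λ p → pt g (pt h p)
    ; ln = λ L → ln g (ln h L)
    ; ptInv = λ p → ptInv h (ptInv g p)
    ; lnInv = λ L → lnInv h (lnInv g L)
    ; ptInvˡ = λ p → trans (cong (ptInv h) (ptInvˡ g (pt h p))) (ptInvˡ h p)
    ; ptInvʳ = λ p → trans (cong (pt g) (ptInvʳ h (ptInv g p))) (ptInvʳ g p)
    ; lnInvˡ = λ L → trans (cong (lnInv h) (lnInvˡ g (ln h L))) (lnInvˡ h L)
    ; lnInvʳ = λ L → trans (cong (ln g) (lnInvʳ h (lnInv g L))) (lnInvʳ g L)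
    ; presI = λ p L → trans (presI g (pt h p) (ln h L)) (presI h p L)
    }
    where open Relation.Binary.PropositionalEquality using (trans; cong)

  invA : Aut → Aut
  invA g = record
    { pt = ptInv g ; ln = lnInv g ; ptInv = pt g ; lnInv = ln g
    ; ptInvˡ = ptInvʳ g ; ptInvʳ = ptInvˡ g ; lnInvˡ = lnInvʳ g ; lnInvʳ = lnInvˡ g
    ; presI = λ p L → sym (trans (cong₂ inc (sym (ptInvʳ g p)) (sym (lnInvʳ g L)))
                                 (presI g (ptInv g p) (lnInv g L)))
    }
    where open Relation.Binary.PropositionalEquality using (sym; trans; cong₂)

  powA : Aut → ℕ → Aut
  powA g zero    = idA
  powA g (suc n) = g ∘A powA g n

  record IsSubgroup (H : Aut → Set) : Set where
    field
      resp  : ∀ g h → g ≈A h → H g → H h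
      hasId : H idA
      hasComp : ∀ g h → H g → H h → H (g ∘A h)
      hasInv  : ∀ g → H g → H (invA g)

  record IsEGQ (x : Point) (H : Aut → Set) : Set where
    field
      subgroup  : IsSubgroup H
      fixLines  : ∀ h → H h → ∀ L → x I L → ln h L ≡ L
      transitive : ∀ y z → ¬ Collinear x y → ¬ Collinear x z →
                     Σ Aut λ h → H h × pt h y ≡ z
      sharp     : ∀ y g h → ¬ Collinear x y → H g → H h →
                     pt g y ≡ pt h y → g ≈A h

  IsSymmetry : Point → Aut → Set
  IsSymmetry x g = ∀ y → Collinear x y → pt g y ≡ y

  -- H contains a (sub)group of exactly t symmetries with center x:
  -- t pairwise distinct elements of H, all symmetries about x,
  -- closed under composition (hence a subgroup, being finite and nonempty
  -- when t ≥ 1).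
  HasSymGroup : ℕ → Point → (Aut → Set) → Set
  HasSymGroup t x H =
    Σ (Fin t → Aut) λ σ →
      (∀ i → H (σ i)) × (∀ i → IsSymmetry x (σ i)) ×
      (∀ i j → i ≢ j → ¬ (σ i ≈A σ j)) ×
      (∀ i j → Σ (Fin t) λ k → (σ i ∘A σ j) ≈A σ k)

  PropStar : Point → (Aut → Set) → Set
  PropStar x H = ∀ h → H h → ∀ y → y ≢ x → Collinear x y → pt h y ≡ y →
                   ∀ L → x I L → y I L → ∀ z → z I L → pt h z ≡ z

  Stab : (Aut → Set) → Line → Aut → Set
  Stab H L h = H h × ln h L ≡ L

  ElemAbelian : (Aut → Set) → Set
  ElemAbelian K =
    (∀ g h → K g → K h → (g ∘A h) ≈A (h ∘A g)) ×
    Σ ℕ λ p → Prime p × (∀ h → K h → powA h p ≈A idA)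

  FixesLinesThrough : Point → Aut → Set
  FixesLinesThrough p g = ∀ M → p I M → ln g M ≡ M

-- Only t < s needs an argument. Let N be the line joining x and p, and let A = H_L.
-- By (*) the pointwise stabilizers in H of the lines through x are normal, and any two of
-- them generate H and intersect in the group of symmetries about x. Hence every element
-- of A commutes with every element of H modulo symmetries. If A is transitive on the t
-- affine lines through some point y of N, then the stabilizer in A of one of them has
-- order at least s/t and, A being abelian, fixes them all; it then centralizes the
-- symmetries, and so fixes every line through p. Suppose there is no such y. Counting
-- orbits, the elements of A fix in total at least 2s² affine lines meeting N. On the other
-- hand s is a power of the exponent of A, so s + t has a prime divisor ℓ not dividing s,
-- and Benson's lemma modulo ℓ shows that for 1 ≠ a in A and every symmetry σ the element
-- aσ fixes an affine line meeting N. Then aσ is conjugate to a. So the t elements aσ fix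
-- equally many of the st affine lines meeting N, and no line is fixed by two of them: each
-- fixes at most s. With the identity this gives 2s² ≤ s² + st, contradicting t < s.

module Submission where

open import Defs
open import Data.Nat using (ℕ; _*_; _≤_)
open import Data.Nat.Divisibility using (_∣_)
open import Data.Fin using (Fin)
open import Data.Product using (Σ; _×_)
open import Relation.Binary.PropositionalEquality using (_≢_)
open import Relation.Nullary using (¬_)

open import Data.Nat using (zero; suc; _+_; _^_; _∸_; _<_; z≤n; s≤s; s≤s⁻¹; NonZero; >-nonZero; ≢-nonZero; nonTrivial⇒≢1; _<?_; _%_; _/_)
open import Data.Nat.Properties
open import Data.Nat.DivMod using ([m+kn]%n≡m%n; m<n⇒m%n≡m; m%n<n; m≡m%n+[m/n]*n; m/n*n≡m)
open import Data.Nat.Divisibility using (divides; ∣m+n∣m⇒∣n; n∣m*n; m∣m*n; ∣m⇒∣m*n; ∣1⇒≡1)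
open import Data.Nat.Primality using (Prime; prime⇒nonTrivial; prime⇒irreducible; euclidsLemma)
open import Data.Nat.Primality.Factorisation using (factorise)
open import Data.Nat.Coprimality using (Coprime; coprime-Bézout; prime⇒coprime; coprime-/gcd)
open import Data.Nat.GCD using (gcd; gcd[m,n]∣m; gcd[m,n]∣n; gcd[m,n]≢0; module Bézout)
open import Data.Nat.Tactic.RingSolver using (solve-∀)
open import Data.Fin as Fin using (zero; suc; toℕ; combine; remQuot)
import Data.Fin.Properties as Fin
open import Data.Bool using (Bool; true; false; _∧_; not)
import Data.Bool.Properties as Bool
open import Data.List using (List; []; _∷_; _++_; length; replicate; [_])
import Data.List.Properties as List
open import Data.List.Relation.Unary.All using (_∷_)
open import Data.Product using (_,_; proj₁; proj₂)
open import Data.Sum using (_⊎_; inj₁; inj₂; [_,_]′)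
open import Function using (_∘_; id)
open import Relation.Nullary using (Dec; yes; no; does; contradiction)
open import Relation.Nullary.Decidable using (dec-true; dec-false; _×-dec_; ¬?)
open import Relation.Binary.Definitions using (tri<; tri≈; tri>)
open import Relation.Binary.PropositionalEquality using (_≡_; refl; sym; trans; cong; cong₂; subst; subst₂; module ≡-Reasoning)
open import Algebra.Properties.Semiring.Sum +-*-semiring using (sum; sum-syntax; sum-cong-≗; ∑-distrib-+; ∑-comm; *-distribˡ-sum; *-distribʳ-sum)

-- Finite sums and indicator functions

ι : Bool → ℕ
ι true  = 1
ι false = 0

ι-∧ : ∀ a b → ι (a ∧ b) ≡ ι a * ι b
ι-∧ true  b = sym (+-identityʳ (ι b))
ι-∧ false b = refl

does⇒ : ∀ {P : Set} (P? : Dec P) → does P? ≡ true → P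
does⇒ (yes p) _ = p

≢true : ∀ {b} → b ≢ true → b ≡ false
≢true {true}  b≢ = contradiction refl b≢
≢true {false} b≢ = refl

⇔⇒≡ : ∀ {a b} → (a ≡ true → b ≡ true) → (b ≡ true → a ≡ true) → a ≡ b
⇔⇒≡ {true}  {true}  f g = refl
⇔⇒≡ {true}  {false} f g = sym (f refl)
⇔⇒≡ {false} {true}  f g = g refl
⇔⇒≡ {false} {false} f g = refl

∧-true : ∀ {a b} → a ≡ true → b ≡ true → a ∧ b ≡ true
∧-true refl refl = refl

∧-trueˡ : ∀ {a b} → a ∧ b ≡ true → a ≡ true
∧-trueˡ {true} _ = refl

∧-trueʳ : ∀ {a b} → a ∧ b ≡ true → b ≡ true
∧-trueʳ {true} e = e

ι-mono : ∀ {a b} → (a ≡ true → b ≡ true) → ι a ≤ ι b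
ι-mono {true}  f rewrite f refl = ≤-refl
ι-mono {false} f = z≤n

∑-const : ∀ n c → sum {n} (λ _ → c) ≡ n * c
∑-const zero    c = refl
∑-const (suc n) c = cong (c +_) (∑-const n c)

∑-mono : ∀ {n} {f g : Fin n → ℕ} → (∀ i → f i ≤ g i) → sum f ≤ sum g
∑-mono {zero}  f≤g = z≤n
∑-mono {suc n} f≤g = +-mono-≤ (f≤g zero) (∑-mono (f≤g ∘ suc))

∑-zero : ∀ {n} {f : Fin n → ℕ} → (∀ i → f i ≡ 0) → sum f ≡ 0
∑-zero {zero}  f≡0 = refl
∑-zero {suc n} f≡0 rewrite f≡0 zero = ∑-zero (f≡0 ∘ suc)

∑-single : ∀ {n} (f : Fin n → ℕ) c → (∀ i → i ≢ c → f i ≡ 0) → sum f ≡ f c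
∑-single {suc n} f zero    h =
  trans (cong (f zero +_) (∑-zero (λ i → h (suc i) (λ ())))) (+-identityʳ _)
∑-single {suc n} f (suc c) h rewrite h zero (λ ()) =
  ∑-single (f ∘ suc) c (λ i i≢c → h (suc i) (i≢c ∘ Fin.suc-injective))

∑ι-unique : ∀ {n} (f : Fin n → Bool) c → f c ≡ true →
            (∀ i → f i ≡ true → i ≡ c) → sum (ι ∘ f) ≡ 1
∑ι-unique f c fc uniq = trans
  (∑-single (ι ∘ f) c (λ i i≢c → cong ι (≢true (i≢c ∘ uniq i))))
  (cong ι fc)

∑ι-≟ : ∀ {n} (c : Fin n) → ∑[ i < n ] ι (does (i Fin.≟ c)) ≡ 1
∑ι-≟ c = ∑ι-unique (λ i → does (i Fin.≟ c)) c (dec-true (c Fin.≟ c) refl) (λ i → does⇒ (i Fin.≟ c))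

∑ι-find : ∀ {n} (f : Fin n → Bool) → sum (ι ∘ f) ≡ 0 ⊎ Σ (Fin n) λ i → f i ≡ true
∑ι-find {zero}  f = inj₁ refl
∑ι-find {suc n} f with f zero in eq
... | true  = inj₂ (zero , eq)
... | false with ∑ι-find (f ∘ suc)
...   | inj₁ z       = inj₁ z
...   | inj₂ (i , e) = inj₂ (suc i , e)

∑ι-atMost : ∀ {n} (f : Fin n → Bool) →
            (∀ i j → f i ≡ true → f j ≡ true → i ≡ j) → sum (ι ∘ f) ≤ 1
∑ι-atMost f uniq with ∑ι-find f
... | inj₁ z        = ≤-trans (≤-reflexive z) z≤n
... | inj₂ (c , fc) = ≤-reflexive (∑ι-unique f c fc (λ i fi → uniq i c fi fc))

-- Expand the left side as a double sum over pairs with `φ i` equal to `j`. Each fibre of `φ` has at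
-- most one element, so `f j` is taken at most once.
∑-injective : ∀ {m n} (φ : Fin m → Fin n) (f : Fin n → ℕ) →
              (∀ i j → φ i ≡ φ j → i ≡ j) → sum (f ∘ φ) ≤ sum f
∑-injective φ f inj = begin
  ∑[ i < _ ] f (φ i)                             ≡⟨ sum-cong-≗ (λ i → sym (pick i)) ⟩
  ∑[ i < _ ] ∑[ j < _ ] (ι (does (φ i Fin.≟ j)) * f j) ≡⟨ ∑-comm (λ i j → ι (does (φ i Fin.≟ j)) * f j) ⟩
  ∑[ j < _ ] ∑[ i < _ ] (ι (does (φ i Fin.≟ j)) * f j)
    ≡⟨ sum-cong-≗ (λ j → sym (*-distribʳ-sum (f j) (λ i → ι (does (φ i Fin.≟ j))))) ⟩
  ∑[ j < _ ] (∑[ i < _ ] ι (does (φ i Fin.≟ j)) * f j) ≤⟨ ∑-mono (λ j → *-monoˡ-≤ (f j) (atMost j)) ⟩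
  ∑[ j < _ ] (1 * f j)                           ≡⟨ sum-cong-≗ (λ j → *-identityˡ (f j)) ⟩
  sum f                                          ∎
  where
  open ≤-Reasoning
  pick : ∀ i → ∑[ j < _ ] (ι (does (φ i Fin.≟ j)) * f j) ≡ f (φ i)
  pick i = trans
    (∑-single _ (φ i) (λ j j≢ → cong (λ b → ι b * f j) (dec-false (φ i Fin.≟ j) (j≢ ∘ sym))))
    (trans (cong (λ b → ι b * f (φ i)) (dec-true (φ i Fin.≟ φ i) refl)) (*-identityˡ _))
  atMost : ∀ j → ∑[ i < _ ] ι (does (φ i Fin.≟ j)) ≤ 1
  atMost j = ∑ι-atMost _ (λ i k ei ek →
    inj i k (trans (does⇒ (φ i Fin.≟ j) ei) (sym (does⇒ (φ k Fin.≟ j) ek))))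

∑-++ : ∀ m {n} (f : Fin (m + n) → ℕ) →
       sum f ≡ ∑[ i < m ] f (i Fin.↑ˡ n) + ∑[ j < n ] f (m Fin.↑ʳ j)
∑-++ zero    f = refl
∑-++ (suc m) f = trans (cong (f zero +_) (∑-++ m (f ∘ suc))) (sym (+-assoc (f zero) _ _))

∑-combine : ∀ m n (f : Fin (m * n) → ℕ) →
            sum f ≡ ∑[ i < m ] ∑[ j < n ] f (combine i j)
∑-combine zero    n f = refl
∑-combine (suc m) n f = trans (∑-++ n f) (cong (∑[ j < n ] f (j Fin.↑ˡ (m * n)) +_) (∑-combine m n (f ∘ (n Fin.↑ʳ_))))

record Enumeration {m : ℕ} (f : Fin m → Bool) (n : ℕ) : Set where
  field
    at        : Fin n → Fin m
    holds     : ∀ i → f (at i) ≡ true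
    injective : ∀ i j → at i ≡ at j → i ≡ j
    index     : ∀ c → f c ≡ true → Σ (Fin n) λ i → at i ≡ c

enumerate : ∀ {m} (f : Fin m → Bool) → Enumeration f (sum (ι ∘ f))
enumerate {zero}  f = record
  { at = λ () ; holds = λ () ; injective = λ () ; index = λ () }
enumerate {suc m} f with f zero in eq | enumerate (f ∘ suc)
... | false | e = record
  { at        = suc ∘ at
  ; holds     = holds
  ; injective = λ i j → injective i j ∘ Fin.suc-injective
  ; index     = λ { zero    fc → contradiction (trans (sym eq) fc) (λ ())
                  ; (suc c) fc → proj₁ (index c fc) , cong suc (proj₂ (index c fc)) }
  } where open Enumeration e
... | true  | e = record
  { at        = λ { zero → zero ; (suc i) → suc (at i) }
  ; holds     = λ { zero → eq ; (suc i) → holds i }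
  ; injective = λ { zero zero _ → refl
                  ; (suc i) (suc j) p → cong suc (injective i j (Fin.suc-injective p)) }
  ; index     = λ { zero    fc → zero , refl
                  ; (suc c) fc → suc (proj₁ (index c fc)) , cong suc (proj₂ (index c fc)) }
  } where open Enumeration e

-- Congruences in ℕ

infix 4 _≈_[mod_]

-- Multiples of `m` are added on both sides, so that no subtraction in ℕ occurs.
record _≈_[mod_] (a b m : ℕ) : Set where
  constructor mkMod
  field
    u v : ℕ
    eq  : a + u * m ≡ b + v * m

module Mod {m : ℕ} where

  ≈-reflexive : ∀ {a b} → a ≡ b → a ≈ b [mod m ]
  ≈-reflexive refl = mkMod 0 0 refl

  ≈-sym : ∀ {a b} → a ≈ b [mod m ] → b ≈ a [mod m ]
  ≈-sym (mkMod u v e) = mkMod v u (sym e)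

  ≈-trans : ∀ {a b c} → a ≈ b [mod m ] → b ≈ c [mod m ] → a ≈ c [mod m ]
  ≈-trans {a} {b} {c} (mkMod u v e) (mkMod u′ v′ e′) = mkMod (u + u′) (v + v′) (begin
    a + (u + u′) * m     ≡⟨ l₁ a u u′ m ⟩
    (a + u * m) + u′ * m ≡⟨ cong (_+ u′ * m) e ⟩
    (b + v * m) + u′ * m ≡⟨ l₂ b v u′ m ⟩
    (b + u′ * m) + v * m ≡⟨ cong (_+ v * m) e′ ⟩
    (c + v′ * m) + v * m ≡⟨ l₃ c v v′ m ⟩
    c + (v + v′) * m     ∎)
    where
    open ≡-Reasoning
    l₁ : ∀ a u u′ m → a + (u + u′) * m ≡ (a + u * m) + u′ * m
    l₁ = solve-∀
    l₂ : ∀ b v u′ m → (b + v * m) + u′ * m ≡ (b + u′ * m) + v * m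
    l₂ = solve-∀
    l₃ : ∀ c v v′ m → (c + v′ * m) + v * m ≡ c + (v + v′) * m
    l₃ = solve-∀

  ≈-+ : ∀ {a b c d} → a ≈ b [mod m ] → c ≈ d [mod m ] → (a + c) ≈ (b + d) [mod m ]
  ≈-+ {a} {b} {c} {d} (mkMod u v e) (mkMod u′ v′ e′) =
    mkMod (u + u′) (v + v′) (trans (l a c u u′ m) (trans (cong₂ _+_ e e′) (sym (l b d v v′ m))))
    where
    l : ∀ a c u u′ m → a + c + (u + u′) * m ≡ (a + u * m) + (c + u′ * m)
    l = solve-∀

  ≈-*ˡ : ∀ c {a b} → a ≈ b [mod m ] → (c * a) ≈ (c * b) [mod m ]
  ≈-*ˡ c {a} {b} (mkMod u v e) = mkMod (c * u) (c * v) (trans (l c a u m) (trans (cong (c *_) e) (sym (l c b v m))))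
    where
    l : ∀ c a u m → c * a + c * u * m ≡ c * (a + u * m)
    l = solve-∀

  ≈-+-cancelʳ : ∀ {a b} c → (a + c) ≈ (b + c) [mod m ] → a ≈ b [mod m ]
  ≈-+-cancelʳ {a} {b} c (mkMod u v e) = mkMod u v (+-cancelʳ-≡ c _ _ (trans (l a c (u * m)) (trans e (sym (l b c (v * m))))))
    where
    l : ∀ a c x → a + x + c ≡ a + c + x
    l = solve-∀

  ≈-∑ : ∀ {n} {f g : Fin n → ℕ} → (∀ i → f i ≈ g i [mod m ]) → sum f ≈ sum g [mod m ]
  ≈-∑ {zero}  f≈g = ≈-reflexive refl
  ≈-∑ {suc n} f≈g = ≈-+ (f≈g zero) (≈-∑ (f≈g ∘ suc))

  +-multiple : ∀ a c → (a + m * c) ≈ a [mod m ]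
  +-multiple a c = mkMod 0 c (trans (+-identityʳ _) (cong (a +_) (*-comm m c)))

  ≈0⇒∣ : ∀ {a} → a ≈ 0 [mod m ] → m ∣ a
  ≈0⇒∣ {a} (mkMod u v e) = ∣m+n∣m⇒∣n (divides v (trans (+-comm (u * m) a) e)) (n∣m*n u)

  ∣⇒≈0 : ∀ {a} → m ∣ a → a ≈ 0 [mod m ]
  ∣⇒≈0 (divides q e) = mkMod 0 q (trans (+-identityʳ _) e)

open Mod

-- Iteration of a function

iter : ∀ {A : Set} → (A → A) → ℕ → A → A
iter f zero    w = w
iter f (suc k) w = f (iter f k w)

module _ {A : Set} (f : A → A) where

  iter-+ : ∀ j k w → iter f (j + k) w ≡ iter f j (iter f k w)
  iter-+ zero    k w = refl
  iter-+ (suc j) k w = cong f (iter-+ j k w)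

  iter-sucʳ : ∀ k w → iter f (suc k) w ≡ iter f k (f w)
  iter-sucʳ k w = trans (cong (λ n → iter f n w) (+-comm 1 k)) (iter-+ k 1 w)

  iter-fixed : ∀ k j w → iter f j w ≡ w → iter f (k * j) w ≡ w
  iter-fixed zero    j w e = refl
  iter-fixed (suc k) j w e =
    trans (iter-+ j (k * j) w) (trans (cong (iter f j) (iter-fixed k j w e)) e)

  -- By Bézout a multiple of one exponent exceeds a multiple of the other by exactly one.
  iter-coprime : ∀ {i j} → Coprime i j → ∀ w → iter f i w ≡ w → iter f j w ≡ w → f w ≡ w
  iter-coprime {i} {j} cop w fixᵢ fixⱼ with coprime-Bézout cop
  ... | Bézout.+- a b e = begin
    f w                   ≡⟨ cong f (iter-fixed b j w fixⱼ) ⟨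
    iter f (1 + b * j) w  ≡⟨ cong (λ n → iter f n w) e ⟩
    iter f (a * i) w      ≡⟨ iter-fixed a i w fixᵢ ⟩
    w                     ∎
    where open ≡-Reasoning
  ... | Bézout.-+ a b e = begin
    f w                   ≡⟨ cong f (iter-fixed a i w fixᵢ) ⟨
    iter f (1 + a * i) w  ≡⟨ cong (λ n → iter f n w) e ⟩
    iter f (b * j) w      ≡⟨ iter-fixed b j w fixⱼ ⟩
    w                     ∎
    where open ≡-Reasoning

-- Rotation of words

rot : ∀ {A : Set} → List A → List A
rot []      = []
rot (c ∷ w) = w ++ [ c ]

rot^ : ∀ {A : Set} → ℕ → List A → List A
rot^ = iter rot

module _ {A : Set} where

  length-rot : (w : List A) → length (rot w) ≡ length w
  length-rot []      = refl
  length-rot (c ∷ w) = trans (List.length-++ w) (+-comm (length w) 1)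

  length-rot^ : ∀ k (w : List A) → length (rot^ k w) ≡ length w
  length-rot^ zero    w = refl
  length-rot^ (suc k) w = trans (length-rot (rot^ k w)) (length-rot^ k w)

  rot^-++ : (v w : List A) → rot^ (length v) (v ++ w) ≡ w ++ v
  rot^-++ []      w = sym (List.++-identityʳ w)
  rot^-++ (c ∷ v) w = begin
    rot^ (suc (length v)) (c ∷ v ++ w)  ≡⟨ iter-sucʳ rot (length v) (c ∷ v ++ w) ⟩
    rot^ (length v) ((v ++ w) ++ [ c ]) ≡⟨ cong (rot^ (length v)) (List.++-assoc v w [ c ]) ⟩
    rot^ (length v) (v ++ (w ++ [ c ])) ≡⟨ rot^-++ v (w ++ [ c ]) ⟩
    (w ++ [ c ]) ++ v                   ≡⟨ List.++-assoc w [ c ] v ⟩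
    w ++ c ∷ v                          ∎
    where open ≡-Reasoning

  rot^-length : ∀ {ℓ} (w : List A) → length w ≡ ℓ → rot^ ℓ w ≡ w
  rot^-length w refl = trans (cong (rot^ (length w)) (sym (List.++-identityʳ w))) (rot^-++ w [])

  rot-fixed⇒replicate : ∀ c (w : List A) → rot (c ∷ w) ≡ c ∷ w → w ≡ replicate (length w) c
  rot-fixed⇒replicate c []      e = refl
  rot-fixed⇒replicate c (d ∷ w) e with List.∷-injective e
  ... | refl , e′ = cong (c ∷_) (rot-fixed⇒replicate c w e′)

  rot-replicate : ∀ n (c : A) → rot (replicate n c) ≡ replicate n c
  rot-replicate zero    c = refl
  rot-replicate (suc n) c = lem n
    where
    lem : ∀ n → replicate n c ++ [ c ] ≡ c ∷ replicate n c
    lem zero    = refl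
    lem (suc n) = cong (c ∷_) (lem n)

-- Sums over all words of a given length

module _ {N : ℕ} where

  ∑ʷ : ℕ → (List (Fin N) → ℕ) → ℕ
  ∑ʷ zero    f = f []
  ∑ʷ (suc n) f = ∑[ c < N ] ∑ʷ n (λ w → f (c ∷ w))

  ∑ʷ-cong : ∀ n {f g} → (∀ w → length w ≡ n → f w ≡ g w) → ∑ʷ n f ≡ ∑ʷ n g
  ∑ʷ-cong zero    h = h [] refl
  ∑ʷ-cong (suc n) h = sum-cong-≗ (λ c → ∑ʷ-cong n (λ w len → h (c ∷ w) (cong suc len)))

  ∑ʷ-zero : ∀ n {f} → (∀ w → length w ≡ n → f w ≡ 0) → ∑ʷ n f ≡ 0
  ∑ʷ-zero zero    h = h [] refl
  ∑ʷ-zero (suc n) h = ∑-zero (λ c → ∑ʷ-zero n (λ w len → h (c ∷ w) (cong suc len)))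

  ∑ʷ-+ : ∀ n f g → ∑ʷ n (λ w → f w + g w) ≡ ∑ʷ n f + ∑ʷ n g
  ∑ʷ-+ zero    f g = refl
  ∑ʷ-+ (suc n) f g = trans (sum-cong-≗ (λ c → ∑ʷ-+ n (f ∘ (c ∷_)) (g ∘ (c ∷_))))
                           (∑-distrib-+ (λ c → ∑ʷ n (f ∘ (c ∷_))) _)

  ∑ʷ-*ˡ : ∀ n a f → ∑ʷ n (λ w → a * f w) ≡ a * ∑ʷ n f
  ∑ʷ-*ˡ zero    a f = refl
  ∑ʷ-*ˡ (suc n) a f = trans (sum-cong-≗ (λ c → ∑ʷ-*ˡ n a (f ∘ (c ∷_))))
                            (sym (*-distribˡ-sum a (λ c → ∑ʷ n (f ∘ (c ∷_)))))

  ∑ʷ-const : ∀ n a → ∑ʷ n (λ _ → a) ≡ N ^ n * a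
  ∑ʷ-const zero    a = sym (*-identityˡ a)
  ∑ʷ-const (suc n) a = trans (sum-cong-≗ {N} (λ c → ∑ʷ-const n a))
    (trans (∑-const N (N ^ n * a)) (sym (*-assoc N (N ^ n) a)))

  ∑ʷ-∑ : ∀ {m} n (f : Fin m → List (Fin N) → ℕ) →
         ∑ʷ n (λ w → ∑[ i < m ] f i w) ≡ ∑[ i < m ] ∑ʷ n (f i)
  ∑ʷ-∑ zero    f = refl
  ∑ʷ-∑ (suc n) f = trans (sum-cong-≗ (λ c → ∑ʷ-∑ n (λ i w → f i (c ∷ w))))
                         (∑-comm (λ c i → ∑ʷ n (λ w → f i (c ∷ w))))

  ∑ʷ-single : ∀ n f w₀ → length w₀ ≡ n → (∀ w → length w ≡ n → w ≢ w₀ → f w ≡ 0) → ∑ʷ n f ≡ f w₀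
  ∑ʷ-single zero    f []       len h = refl
  ∑ʷ-single (suc n) f (c ∷ w₀) len h = trans
    (∑-single _ c (λ d d≢c → ∑ʷ-zero n (λ w l → h (d ∷ w) (cong suc l) (d≢c ∘ List.∷-injectiveˡ))))
    (∑ʷ-single n (f ∘ (c ∷_)) w₀ (suc-injective len) (λ w l w≢ → h (c ∷ w) (cong suc l) (w≢ ∘ List.∷-injectiveʳ)))

  -- Exchanging finite sums brings the last letter to the front, which makes `∑ʷ` invariant under
  -- rotation.
  ∑ʷ-∷ʳ : ∀ n f → ∑[ c < N ] ∑ʷ n (λ w → f (w ++ [ c ])) ≡ ∑ʷ (suc n) f
  ∑ʷ-∷ʳ zero    f = refl
  ∑ʷ-∷ʳ (suc n) f = trans (∑-comm (λ c d → ∑ʷ n (λ w → f (d ∷ w ++ [ c ]))))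
                          (sum-cong-≗ (λ d → ∑ʷ-∷ʳ n (f ∘ (d ∷_))))

  ∑ʷ-rot : ∀ n f → ∑ʷ n (f ∘ rot) ≡ ∑ʷ n f
  ∑ʷ-rot zero    f = refl
  ∑ʷ-rot (suc n) f = ∑ʷ-∷ʳ n f

  ∑ʷ-rot^ : ∀ k n f → ∑ʷ n (f ∘ rot^ k) ≡ ∑ʷ n f
  ∑ʷ-rot^ zero    n f = refl
  ∑ʷ-rot^ (suc k) n f = trans (∑ʷ-rot^ k n (f ∘ rot)) (∑ʷ-rot n f)

  -- A base `N` numeral whose units digit is the first letter. It orders the words of one length
  -- linearly and so singles out a word in a rotation class.
  code : List (Fin N) → ℕ
  code []      = 0
  code (c ∷ w) = toℕ c + code w * N

  code-injective : ∀ v w → length v ≡ length w → code v ≡ code w → v ≡ w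
  code-injective []      []      _   _ = refl
  code-injective (c ∷ v) (d ∷ w) len e =
    cong₂ _∷_ c≡d (code-injective v w (suc-injective len) codes)
    where
    instance
      N≢0 : NonZero N
      N≢0 = Fin.nonZeroIndex c
    digit : ∀ (c : Fin N) k → (toℕ c + k * N) % N ≡ toℕ c
    digit c k = trans ([m+kn]%n≡m%n (toℕ c) k N) (m<n⇒m%n≡m (Fin.toℕ<n c))
    c≡d : c ≡ d
    c≡d = Fin.toℕ-injective (trans (sym (digit c (code v))) (trans (cong (_% N) e) (digit d (code w))))
    codes : code v ≡ code w
    codes = *-cancelʳ-≡ (code v) (code w) N (+-cancelˡ-≡ (toℕ c) _ _
      (trans e (cong (λ x → toℕ x + code w * N) (sym c≡d))))

-- Rotation classes of words of prime length

argmin : ∀ {n} (u : Fin (suc n) → ℕ) → Σ (Fin (suc n)) λ k → ∀ i → u k ≤ u i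
argmin {zero}  u = zero , λ { zero → ≤-refl }
argmin {suc n} u with argmin (u ∘ suc)
... | k , least with ≤-total (u zero) (u (suc k))
...   | inj₁ le = zero  , λ { zero → ≤-refl ; (suc i) → ≤-trans le (least i) }
...   | inj₂ ge = suc k , λ { zero → ge ; (suc i) → least i }

-- A sequence of period n+1 whose values at unequal residues differ attains its
-- least value at exactly one residue.
module StrictMinimum (n : ℕ) (u : ℕ → ℕ) (periodic : ∀ k → u (k + suc n) ≡ u k)
  (separates : ∀ k j → 0 < j → j < suc n → u (j + k) ≢ u k) where

  periodic* : ∀ a k → u (k + a * suc n) ≡ u k
  periodic* zero    k = cong u (+-identityʳ k)
  periodic* (suc a) k = trans (cong u (lem k (suc n) (a * suc n))) (trans (periodic (k + a * suc n)) (periodic* a k))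
    where
    lem : ∀ k x y → k + (x + y) ≡ k + y + x
    lem = solve-∀

  minimum : Σ (Fin (suc n)) λ k → ∀ (j : Fin n) → u (toℕ k) < u (suc (toℕ j) + toℕ k)
  minimum with argmin {n} (u ∘ toℕ)
  ... | k , least = k , λ j → ≤∧≢⇒< (below (suc (toℕ j) + toℕ k))
        (separates (toℕ k) (suc (toℕ j)) (s≤s z≤n) (s≤s (Fin.toℕ<n j)) ∘ sym)
    where
    below : ∀ i → u (toℕ k) ≤ u i
    below i = begin
      u (toℕ k)                           ≤⟨ least (Fin.fromℕ< (m%n<n i (suc n))) ⟩
      u (toℕ (Fin.fromℕ< (m%n<n i (suc n)))) ≡⟨ cong u (Fin.toℕ-fromℕ< (m%n<n i (suc n))) ⟩
      u (i % suc n)                       ≡⟨ periodic* (i / suc n) (i % suc n) ⟨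
      u (i % suc n + i / suc n * suc n)   ≡⟨ cong u (m≡m%n+[m/n]*n i (suc n)) ⟨
      u i                                 ∎
      where open ≤-Reasoning

  -- A shift by less than the period leads from `k` forward to `l`, and another one from `l` past
  -- the end of the period back to `k`. Each value would be smaller than the other.
  unique< : ∀ (k l : Fin (suc n)) → toℕ k < toℕ l →
            (∀ (j : Fin n) → u (toℕ k) < u (suc (toℕ j) + toℕ k)) →
            (∀ (j : Fin n) → u (toℕ l) < u (suc (toℕ j) + toℕ l)) → ∀ {ℓ} {A : Set ℓ} → A
  unique< k l k<l mk ml with m<n⇒∃[o]m+o≡n k<l | m<n⇒∃[o]m+o≡n (Fin.toℕ<n l)
    where
    m<n⇒∃[o]m+o≡n : ∀ {m n} → m < n → Σ ℕ λ o → suc o + m ≡ n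
    m<n⇒∃[o]m+o≡n {m} {n} m<n = n ∸ suc m , trans (sym (+-suc (n ∸ suc m) m)) (m∸n+n≡m m<n)
  ... | a , ea | b , eb = contradiction (<-trans k<l′ l<k) (<-irrefl refl)
    where
    k<l′ : u (toℕ k) < u (toℕ l)
    k<l′ = subst (λ i → u (toℕ k) < u i)
      (trans (cong (λ i → suc i + toℕ k) (Fin.toℕ-fromℕ< a<n)) ea) (mk (Fin.fromℕ< a<n))
      where
      a<n : a < n
      a<n = s≤s⁻¹ (≤-trans (s≤s (≤-trans (m≤m+n (suc a) (toℕ k)) (≤-reflexive ea))) (Fin.toℕ<n l))
    shift : suc (b + toℕ k) + toℕ l ≡ toℕ k + suc n
    shift = trans (lem b (toℕ k) (toℕ l)) (cong (toℕ k +_) eb)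
      where
      lem : ∀ b k l → suc (b + k) + l ≡ k + (suc b + l)
      lem = solve-∀
    l<k : u (toℕ l) < u (toℕ k)
    l<k = subst (u (toℕ l) <_)
      (trans (cong u (trans (cong (λ i → suc i + toℕ l) (Fin.toℕ-fromℕ< b+k<n)) shift)) (periodic (toℕ k)))
      (ml (Fin.fromℕ< b+k<n))
      where
      b+k<n : b + toℕ k < n
      b+k<n = s≤s⁻¹ (≤-trans (s≤s (≤-trans (≤-reflexive (sym (+-suc b (toℕ k)))) (+-monoʳ-≤ b k<l))) (≤-reflexive eb))

  unique : ∀ (k l : Fin (suc n)) →
           (∀ (j : Fin n) → u (toℕ k) < u (suc (toℕ j) + toℕ k)) →
           (∀ (j : Fin n) → u (toℕ l) < u (suc (toℕ j) + toℕ l)) → k ≡ l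
  unique k l mk ml with Fin.<-cmp k l
  ... | tri< k<l _ _ = unique< k l k<l mk ml
  ... | tri≈ _ k≡l _ = k≡l
  ... | tri> _ _ l<k = unique< l k l<k ml mk

-- The non-constant words of prime length fall into rotation classes of full size; in
-- each of them exactly one word has a strictly smaller code than its proper rotations.
module _ {N : ℕ} (m : ℕ) (prime : Prime (suc (suc m))) where
  private
    ℓ : ℕ
    ℓ = suc (suc m)

    Least : List (Fin N) → Set
    Least w = ∀ (j : Fin (suc m)) → code w < code (rot^ (suc (toℕ j)) w)

    least? : ∀ w → Dec (Least w)
    least? w = Fin.all? (λ j → code w <? code (rot^ (suc (toℕ j)) w))

    constant? : ∀ (w : List (Fin N)) → Dec (rot w ≡ w)
    constant? w = List.≡-dec Fin._≟_ (rot w) w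

    χ κ : List (Fin N) → ℕ
    χ w = ι (does (least? w))
    κ w = ι (does (constant? w))

    -- Rotating `k * ℓ` times restores `w`. The first `k` of these rotations yield `rot^ k w` and
    -- the others leave it unchanged, so `w` equals `rot^ k w`.
    fixed⇒constant : ∀ (w : List (Fin N)) → length w ≡ ℓ → ∀ k → rot (rot^ k w) ≡ rot^ k w → rot w ≡ w
    fixed⇒constant w len k fix = subst (λ v → rot v ≡ v) (sym w≡) fix
      where
      open ≡-Reasoning
      w≡ : w ≡ rot^ k w
      w≡ = begin
        w                            ≡⟨ iter-fixed rot k ℓ w (rot^-length w len) ⟨
        rot^ (k * ℓ) w               ≡⟨ cong (λ i → rot^ i w) (trans (*-suc k (suc m)) (+-comm k _)) ⟩
        rot^ (k * suc m + k) w       ≡⟨ iter-+ rot (k * suc m) k w ⟩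
        rot^ (k * suc m) (rot^ k w)  ≡⟨ cong (λ i → rot^ i (rot^ k w)) (sym (*-identityʳ (k * suc m))) ⟩
        rot^ (k * suc m * 1) (rot^ k w) ≡⟨ iter-fixed rot (k * suc m) 1 (rot^ k w) fix ⟩
        rot^ k w                     ∎

    partition : ∀ w → length w ≡ ℓ → κ w + ∑[ k < ℓ ] χ (rot^ (toℕ k) w) ≡ 1
    partition w len with constant? w
    ... | yes fix = cong suc (∑-zero {ℓ} (λ k → cong ι (dec-false (least? (rot^ (toℕ k) w)) (notLeast (toℕ k)))))
      where
      rot^k : ∀ k → rot^ k w ≡ w
      rot^k zero    = refl
      rot^k (suc k) = trans (cong rot (rot^k k)) fix
      notLeast : ∀ k → ¬ Least (rot^ k w)
      notLeast k least = <-irrefl (cong code (trans (rot^k k) (sym (rot^k (suc k))))) (least zero)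
    ... | no ¬fix = ∑ι-unique {ℓ} (λ k → does (least? (rot^ (toℕ k) w))) (proj₁ minimum)
          (dec-true (least? (rot^ (toℕ (proj₁ minimum)) w)) (λ j → subst (code (rot^ (toℕ (proj₁ minimum)) w) <_)
                (cong code (iter-+ rot (suc (toℕ j)) (toℕ (proj₁ minimum)) w)) (proj₂ minimum j)))
          (λ k e → unique k (proj₁ minimum)
             (λ j → subst (code (rot^ (toℕ k) w) <_) (cong code (sym (iter-+ rot (suc (toℕ j)) (toℕ k) w)))
                      (does⇒ (least? (rot^ (toℕ k) w)) e j))
             (proj₂ minimum))
      where
      u : ℕ → ℕ
      u k = code {N} (rot^ k w)
      periodic : ∀ k → u (k + ℓ) ≡ u k
      periodic k = cong code (trans (iter-+ rot k ℓ w)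
        (cong (rot^ k) (rot^-length w len)))
      separates : ∀ k j → 0 < j → j < ℓ → u (j + k) ≢ u k
      -- Equal codes would give `rot^ k w` the period `suc j` besides `ℓ`. These are coprime, so a
      -- single rotation would fix it.
      separates k (suc j) _ j<ℓ e = ¬fix (fixed⇒constant w len k
        (iter-coprime rot (prime⇒coprime prime j<ℓ) (rot^ k w) (rot^-length (rot^ k w) (trans (length-rot^ k w) len))
          (trans (sym (iter-+ rot (suc j) k w))
            (code-injective _ _ (trans (length-rot^ (suc j + k) w) (sym (length-rot^ k w))) e))))
      open StrictMinimum (suc m) u periodic separates

  -- By `partition` each word is counted once, either as a constant or through its unique least
  -- rotation. A sum over all words does not change under rotation, so the `ℓ` shifts of the second
  -- kind contribute equally and together give a multiple of `ℓ`.
  ∑ʷ-rotationInvariant : (f : List (Fin N) → ℕ) → (∀ w → f (rot w) ≡ f w) →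
    ∑ʷ ℓ f ≈ ∑[ c < N ] f (replicate ℓ c) [mod ℓ ]
  ∑ʷ-rotationInvariant f inv = ≈-trans (≈-reflexive split) (+-multiple _ (∑ʷ ℓ (λ w → f w * χ w)))
    where
    open ≡-Reasoning
    inv^ : ∀ k (w : List (Fin N)) → f (rot^ k w) ≡ f w
    inv^ zero    w = refl
    inv^ (suc k) w = trans (inv (rot^ k w)) (inv^ k w)

    pointwise : ∀ w → length w ≡ ℓ →
      f w ≡ f w * κ w + ∑[ k < ℓ ] (f (rot^ (toℕ k) w) * χ (rot^ (toℕ k) w))
    pointwise w len = begin
      f w                                                        ≡⟨ *-identityʳ (f w) ⟨
      f w * 1                                                    ≡⟨ cong (f w *_) (partition w len) ⟨
      f w * (κ w + ∑[ k < ℓ ] χ (rot^ (toℕ k) w))                ≡⟨ *-distribˡ-+ (f w) (κ w) _ ⟩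
      f w * κ w + f w * ∑[ k < ℓ ] χ (rot^ (toℕ k) w)
        ≡⟨ cong (f w * κ w +_) (*-distribˡ-sum {ℓ} (f w) (λ k → χ (rot^ (toℕ k) w))) ⟩
      f w * κ w + ∑[ k < ℓ ] (f w * χ (rot^ (toℕ k) w))          ≡⟨ cong (f w * κ w +_) (sum-cong-≗ {ℓ}
          {λ k → f w * χ (rot^ (toℕ k) w)} {λ k → f (rot^ (toℕ k) w) * χ (rot^ (toℕ k) w)}
          (λ k → cong (_* χ (rot^ (toℕ k) w)) (sym (inv^ (toℕ k) w)))) ⟩
      f w * κ w + ∑[ k < ℓ ] (f (rot^ (toℕ k) w) * χ (rot^ (toℕ k) w)) ∎

    constants : ∑ʷ ℓ (λ w → f w * κ w) ≡ ∑[ c < N ] f (replicate ℓ c)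
    constants = sum-cong-≗ λ c → trans
      (∑ʷ-single (suc m) _ (replicate (suc m) c) (List.length-replicate (suc m))
        (λ w len w≢ → trans
          (cong (λ b → f (c ∷ w) * ι b) (dec-false (constant? (c ∷ w))
            (λ fix → w≢ (trans (rot-fixed⇒replicate c w fix) (cong (λ n → replicate n c) len)))))
          (*-zeroʳ (f (c ∷ w)))))
      (trans (cong (λ b → f (replicate ℓ c) * ι b) (dec-true (constant? (replicate ℓ c)) (rot-replicate ℓ c)))
             (*-identityʳ _))

    split : ∑ʷ ℓ f ≡ ∑[ c < N ] f (replicate ℓ c) + ℓ * ∑ʷ ℓ (λ w → f w * χ w)
    split = begin
      ∑ʷ ℓ f
        ≡⟨ ∑ʷ-cong ℓ pointwise ⟩
      ∑ʷ ℓ (λ w → f w * κ w + ∑[ k < ℓ ] (f (rot^ (toℕ k) w) * χ (rot^ (toℕ k) w)))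
        ≡⟨ ∑ʷ-+ ℓ (λ w → f w * κ w) (λ w → ∑[ k < ℓ ] (f (rot^ (toℕ k) w) * χ (rot^ (toℕ k) w))) ⟩
      ∑ʷ ℓ (λ w → f w * κ w) + ∑ʷ ℓ (λ w → ∑[ k < ℓ ] (f (rot^ (toℕ k) w) * χ (rot^ (toℕ k) w)))
        ≡⟨ cong₂ _+_ constants (∑ʷ-∑ ℓ (λ (k : Fin ℓ) w → f (rot^ (toℕ k) w) * χ (rot^ (toℕ k) w))) ⟩
      ∑[ c < N ] f (replicate ℓ c) + ∑[ k < ℓ ] ∑ʷ ℓ (λ w → f (rot^ (toℕ k) w) * χ (rot^ (toℕ k) w))
        ≡⟨ cong (∑[ c < N ] f (replicate ℓ c) +_) (sum-cong-≗ {ℓ}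
          {λ k → ∑ʷ ℓ (λ w → f (rot^ (toℕ k) w) * χ (rot^ (toℕ k) w))}
          {λ _ → ∑ʷ ℓ (λ w → f w * χ w)} (λ k → ∑ʷ-rot^ (toℕ k) ℓ (λ w → f w * χ w))) ⟩
      ∑[ c < N ] f (replicate ℓ c) + ∑[ k < ℓ ] ∑ʷ ℓ (λ w → f w * χ w)
        ≡⟨ cong (∑[ c < N ] f (replicate ℓ c) +_) (∑-const ℓ (∑ʷ ℓ (λ w → f w * χ w))) ⟩
      ∑[ c < N ] f (replicate ℓ c) + ℓ * ∑ʷ ℓ (λ w → f w * χ w) ∎

-- Fermat's congruence and traces of matrix powers

module _ (m : ℕ) (prime : Prime (suc (suc m))) where
  private
    ℓ : ℕ
    ℓ = suc (suc m)

  -- There are `a ^ ℓ` words over `a` letters, and `a` of them are constant.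
  fermat : ∀ a → (a ^ ℓ) ≈ a [mod ℓ ]
  fermat a = ≈-trans (≈-reflexive (trans (sym (*-identityʳ (a ^ ℓ))) (sym (∑ʷ-const {a} ℓ 1))))
    (≈-trans (∑ʷ-rotationInvariant {a} m prime (λ _ → 1) (λ _ → refl))
             (≈-reflexive (trans (∑-const a 1) (*-identityʳ a))))

  -- The trace of T^ℓ counts closed walks of length ℓ, which may be rotated.
  module Trace {N : ℕ} (T : Fin N → Fin N → ℕ) where

    path : Fin N → List (Fin N) → Fin N → ℕ
    path a []      b = T a b
    path a (c ∷ w) b = T a c * path c w b

    closed : List (Fin N) → ℕ
    -- A default value: only words of length `ℓ`, which is at least 2, are summed.
    closed []      = 0
    closed (c ∷ w) = path c w c

    path-∷ʳ : ∀ a w c b → path a (w ++ [ c ]) b ≡ path a w c * T c b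
    path-∷ʳ a []      c b = refl
    path-∷ʳ a (d ∷ w) c b = trans (cong (T a d *_) (path-∷ʳ d w c b))
                                  (sym (*-assoc (T a d) (path d w c) (T c b)))

    closed-rot : ∀ w → closed (rot w) ≡ closed w
    closed-rot []          = refl
    closed-rot (c ∷ [])    = refl
    closed-rot (c ∷ d ∷ w) = trans (path-∷ʳ d w c d) (*-comm (path d w c) (T c d))

    path-replicate : ∀ n c → path c (replicate n c) c ≡ T c c ^ suc n
    path-replicate zero    c = sym (*-identityʳ (T c c))
    path-replicate (suc n) c = cong (T c c *_) (path-replicate n c)

    -- A constant word is a loop run through `ℓ` times; its weight `T c c ^ ℓ` reduces to `T c c` by
    -- Fermat.
    trace^ℓ : ∑ʷ ℓ closed ≈ ∑[ c < N ] T c c [mod ℓ ]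
    trace^ℓ = ≈-trans (∑ʷ-rotationInvariant m prime closed closed-rot)
      (≈-∑ (λ c → ≈-trans (≈-reflexive (path-replicate (suc m) c)) (fermat (T c c))))

    module _ {r u : ℕ} (rows : ∀ a → ∑[ c < N ] T a c ≡ r)
             (square : ∀ a b → ∑[ c < N ] (T a c * T c b) ≈ u [mod ℓ ]) where

      -- The letters of the word are the interior vertices. The last two steps are governed by
      -- `square`, and each earlier one contributes a factor `r`, a row sum.
      paths : ∀ n a b → ∑ʷ (suc n) (λ w → path a w b) ≈ (r ^ n * u) [mod ℓ ]
      paths zero    a b = ≈-trans (square a b) (≈-reflexive (sym (*-identityˡ u)))
      paths (suc n) a b = ≈-trans
        (≈-reflexive (sum-cong-≗ (λ c → ∑ʷ-*ˡ (suc n) (T a c) (λ w → path c w b))))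
        (≈-trans (≈-∑ (λ c → ≈-*ˡ (T a c) (paths n c b)))
          (≈-reflexive (trans (sym (*-distribʳ-sum (r ^ n * u) (T a)))
            (trans (cong (_* (r ^ n * u)) (rows a)) (sym (*-assoc r (r ^ n) u))))))

      -- The right side depends on `T` only through `r` and `u`, so two matrices sharing these have
      -- congruent traces.
      trace : ∑[ c < N ] T c c ≈ (N * (r ^ m * u)) [mod ℓ ]
      trace = ≈-trans (≈-sym trace^ℓ)
        (≈-trans (≈-∑ (λ c → paths m c c)) (≈-reflexive (∑-const N (r ^ m * u))))

-- Cauchy's theorem and prime divisors

prime⇒2+ : ∀ {ℓ} → Prime ℓ → Σ ℕ λ m → ℓ ≡ suc (suc m)
prime⇒2+ {zero}        pr with () ← prime⇒nonTrivial pr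
prime⇒2+ {suc zero}    pr with () ← prime⇒nonTrivial pr
prime⇒2+ {suc (suc m)} pr = m , refl

-- McKay's proof of Cauchy's theorem: f w says that the product of the word w is 1.
cauchy : ∀ {ℓ N} → Prime ℓ → (f : List (Fin N) → Bool) → (∀ w → f (rot w) ≡ f w) →
         (∀ w → Σ (Fin N) λ c → f (c ∷ w) ≡ true × (∀ d → f (d ∷ w) ≡ true → d ≡ c)) →
         ℓ ∣ N → ∀ c₀ → f (replicate ℓ c₀) ≡ true →
         Σ (Fin N) λ c → c ≢ c₀ × f (replicate ℓ c) ≡ true
cauchy {ℓ} {N} pr f inv uniq ℓ∣N c₀ fc₀ with prime⇒2+ pr
... | m , refl with ∑ι-find (λ c → f (replicate ℓ c) ∧ not (does (c Fin.≟ c₀)))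
... | inj₂ (c , e) = c , c≢ (c Fin.≟ c₀) (∧-trueʳ {f (replicate ℓ c)} e) , ∧-trueˡ e
  where
  c≢ : (d : Dec (c ≡ c₀)) → not (does d) ≡ true → c ≢ c₀
  c≢ (no ¬p) _ = ¬p
... | inj₁ none = contradiction (∣1⇒≡1 (≈0⇒∣ one≈0)) λ ()
  where
  others : ∀ c → c ≢ c₀ → ι (f (replicate ℓ c)) ≡ 0
  others c c≢c₀ = cong ι (≢true λ e → absurd (trans (sym (∑-zeroʳ c))
    (cong ι (∧-true e (cong not (dec-false (c Fin.≟ c₀) c≢c₀))))))
    where
    absurd : 0 ≢ 1
    absurd ()
    ∑-zeroʳ : ∀ c → ι (f (replicate ℓ c) ∧ not (does (c Fin.≟ c₀))) ≡ 0
    ∑-zeroʳ = ∑≡0 none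
      where
      ∑≡0 : ∀ {n} {g : Fin n → ℕ} → sum g ≡ 0 → ∀ i → g i ≡ 0
      ∑≡0 {suc n} {g} e zero    = m+n≡0⇒m≡0 (g zero) e
      ∑≡0 {suc n} {g} e (suc i) = ∑≡0 (m+n≡0⇒n≡0 (g zero) e) i
  -- The tail of a word is arbitrary, and its first letter is then forced by `uniq`.
  count : ∑ʷ ℓ (ι ∘ f) ≡ N ^ suc m * 1
  count = trans (sym (∑ʷ-∑ (suc m) (λ c w → ι (f (c ∷ w)))))
    (trans (∑ʷ-cong (suc m) (λ w _ → ∑ι-unique _ (proj₁ (uniq w)) (proj₁ (proj₂ (uniq w))) (proj₂ (proj₂ (uniq w)))))
           (∑ʷ-const {N} (suc m) 1))
  -- The only constant word left is that of `c₀`, which counts 1, whereas the total is a positive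
  -- power of `N` and so divisible by `ℓ`.
  one≈0 : 1 ≈ 0 [mod ℓ ]
  one≈0 = ≈-trans (≈-reflexive (sym (trans (∑-single _ c₀ others) (cong ι fc₀))))
    (≈-trans (≈-sym (∑ʷ-rotationInvariant m pr (ι ∘ f) (cong ι ∘ inv)))
      (≈-trans (≈-reflexive count) (∣⇒≈0 (∣m⇒∣m*n 1 (∣m⇒∣m*n (N ^ m) ℓ∣N)))))

primeDivisor : ∀ n → 1 < n → Σ ℕ λ ℓ → Prime ℓ × ℓ ∣ n
primeDivisor n 1<n with factorise n {{>-nonZero (<-trans (s≤s z≤n) 1<n)}}
... | record { factors = [] ; isFactorisation = e } = contradiction (sym e) (<⇒≢ 1<n)
... | record { factors = ℓ ∷ ns ; isFactorisation = e ; factorsPrime = pr ∷ _ } =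
  ℓ , pr , subst (ℓ ∣_) (sym e) (m∣m*n _)

-- Divide `s` and `t` by their gcd and let `ℓ` divide `s′ + t′`. If `ℓ` divided `s`, it would be
-- `p`, which also divides `s′` because `s′` exceeds 1. Then `ℓ` would divide both `s′` and `t′`,
-- which are coprime.
primeDivisor-+ : ∀ s t p → 0 < t → t < s → (∀ ℓ → Prime ℓ → ℓ ∣ s → ℓ ≡ p) →
                 Σ ℕ λ ℓ → Prime ℓ × ℓ ∣ s + t × ¬ (ℓ ∣ s)
primeDivisor-+ s t p 0<t t<s only-p = ℓ , pr , ℓ∣s+t , ℓ∤s
  where
  g : ℕ
  g = gcd s t
  instance
    g≢0 : NonZero g
    g≢0 = ≢-nonZero (gcd[m,n]≢0 s t (inj₂ (m<n⇒n≢0 0<t)))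
  s′ t′ : ℕ
  s′ = s / g
  t′ = t / g
  s≡ : s′ * g ≡ s
  s≡ = m/n*n≡m (gcd[m,n]∣m s t)
  t≡ : t′ * g ≡ t
  t≡ = m/n*n≡m (gcd[m,n]∣n s t)
  t′<s′ : t′ < s′
  t′<s′ = *-cancelʳ-< g t′ s′ (subst₂ _<_ (sym t≡) (sym s≡) t<s)
  0<t′ : 0 < t′
  0<t′ = n≢0⇒n>0 λ t′≡0 → m<n⇒n≢0 0<t (trans (sym t≡) (cong (_* g) t′≡0))
  1<s′ : 1 < s′
  1<s′ = ≤-trans (s≤s 0<t′) t′<s′
  found : Σ ℕ λ ℓ → Prime ℓ × ℓ ∣ s′ + t′
  found = primeDivisor (s′ + t′) (≤-trans 1<s′ (m≤m+n s′ t′))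
  ℓ : ℕ
  ℓ = proj₁ found
  pr : Prime ℓ
  pr = proj₁ (proj₂ found)
  ℓ∣s+t : ℓ ∣ s + t
  ℓ∣s+t = subst (ℓ ∣_) (trans (*-distribʳ-+ g s′ t′) (cong₂ _+_ s≡ t≡)) (∣m⇒∣m*n g (proj₂ (proj₂ found)))
  ℓ∤s : ¬ (ℓ ∣ s)
  ℓ∤s ℓ∣s = nonTrivial⇒≢1 {{prime⇒nonTrivial pr}} (coprime-/gcd s t (ℓ∣s′ , ∣m+n∣m⇒∣n (proj₂ (proj₂ found)) ℓ∣s′))
    where
    divisor : Σ ℕ λ ℓ → Prime ℓ × ℓ ∣ s′
    divisor = primeDivisor s′ 1<s′
    ℓ∣s′ : ℓ ∣ s′
    ℓ∣s′ = subst (_∣ s′)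
      (trans (only-p _ (proj₁ (proj₂ divisor)) (subst (proj₁ divisor ∣_) s≡ (∣m⇒∣m*n g (proj₂ (proj₂ divisor)))))
             (sym (only-p ℓ pr ℓ∣s)))
      (proj₂ (proj₂ divisor))

-- Counting after the deletion of one element

countF≡∑ : ∀ {n} (f : Fin n → Bool) → countF f ≡ sum (ι ∘ f)
countF≡∑ {zero}  f = refl
countF≡∑ {suc n} f with f zero
... | true  = cong suc (countF≡∑ (f ∘ suc))
... | false = countF≡∑ (f ∘ suc)

infixl 6 _∖_

_∖_ : ∀ {m} → (Fin m → Bool) → Fin m → Fin m → Bool
(f ∖ a) v = f v ∧ not (does (v Fin.≟ a))

∖-intro : ∀ {m} (f : Fin m → Bool) {a v} → f v ≡ true → v ≢ a → (f ∖ a) v ≡ true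
∖-intro f {a} {v} fv v≢a = ∧-true fv (cong not (dec-false (v Fin.≟ a) v≢a))

∖-elim : ∀ {m} (f : Fin m → Bool) {a v} → (f ∖ a) v ≡ true → f v ≡ true × v ≢ a
∖-elim f {a} {v} e = ∧-trueˡ e , v≢a (v Fin.≟ a) (∧-trueʳ {f v} e)
  where
  v≢a : (d : Dec (v ≡ a)) → not (does d) ≡ true → v ≢ a
  v≢a (no ¬p) _ = ¬p

∑-∖ : ∀ {m n} (f : Fin m → Bool) {a} → f a ≡ true → sum (ι ∘ f) ≡ suc n → sum (ι ∘ (f ∖ a)) ≡ n
∑-∖ {n = n} f {a} fa e = suc-injective (begin
  suc (sum (ι ∘ (f ∖ a)))                        ≡⟨ +-comm 1 _ ⟩
  sum (ι ∘ (f ∖ a)) + 1                          ≡⟨ cong (sum (ι ∘ (f ∖ a)) +_) (∑ι-≟ a) ⟨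
  sum (ι ∘ (f ∖ a)) + ∑[ v < _ ] ι (does (v Fin.≟ a))
    ≡⟨ ∑-distrib-+ (ι ∘ (f ∖ a)) (λ v → ι (does (v Fin.≟ a))) ⟨
  ∑[ v < _ ] (ι ((f ∖ a) v) + ι (does (v Fin.≟ a)))   ≡⟨ sum-cong-≗ split ⟨
  sum (ι ∘ f)                                    ≡⟨ e ⟩
  suc n                                          ∎)
  where
  open ≡-Reasoning
  split : ∀ v → ι (f v) ≡ ι ((f ∖ a) v) + ι (does (v Fin.≟ a))
  split v with v Fin.≟ a
  ... | yes refl rewrite fa = refl
  ... | no _ with f v
  ...   | true  = refl
  ...   | false = refl

abstract
  enumerate∖ : ∀ {m n} (f : Fin m → Bool) {a} → f a ≡ true → countF f ≡ suc n → Enumeration (f ∖ a) n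
  enumerate∖ f {a} fa e = subst (Enumeration (f ∖ a)) (∑-∖ f fa (trans (sym (countF≡∑ f)) e)) (enumerate (f ∖ a))

injective⇒surjective : ∀ {n} (φ : Fin n → Fin n) → (∀ i j → φ i ≡ φ j → i ≡ j) →
                       ∀ k → Σ (Fin n) λ i → φ i ≡ k
injective⇒surjective {suc n} φ inj k with Fin.any? (λ i → φ i Fin.≟ k)
... | yes hit = hit
... | no miss = contradiction (Fin.injective⇒≤ {f = ψ} ψ-inj) 1+n≰n
  where
  k≢ : ∀ i → k ≢ φ i
  k≢ i e = miss (i , sym e)
  ψ : Fin (suc n) → Fin n
  ψ i = Fin.punchOut (k≢ i)
  ψ-inj : ∀ {i j} → ψ i ≡ ψ j → i ≡ j
  ψ-inj {i} {j} e = inj i j (Fin.punchOut-injective (k≢ i) (k≢ j) e)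

-- Symmetries and commutation in the elation quadrangle

module ElationGQ (S : IncStr) (s t : ℕ) (x : Point S) (H : Aut S → Set)
  (gq : IsGQ S s t) (thick : Thick S s t)
  (egq : IsEGQ S x H) (syms : HasSymGroup S t x H) (star : PropStar S x H) where

  open IncStr S public
  open IsGQ gq public
  open IsEGQ egq public
  open IsSubgroup subgroup public

  infix  4 _∈_ _∉_ _~_ _≐_
  infixr 8 _·_ _∙_ _∘ᴬ_
  infix  9 _⁻¹

  _∈_ _∉_ : Point S → Line S → Set
  p ∈ L = inc p L ≡ true
  p ∉ L = ¬ p ∈ L

  _~_ : Point S → Point S → Set
  p ~ q = Collinear S p q

  _≐_ : Aut S → Aut S → Set
  _≐_ = _≈A_ S

  _·_ : Aut S → Point S → Point S
  g · p = pt g p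

  _∙_ : Aut S → Line S → Line S
  g ∙ L = ln g L

  _∘ᴬ_ : Aut S → Aut S → Aut S
  _∘ᴬ_ = _∘A_ S

  _⁻¹ : Aut S → Aut S
  _⁻¹ = invA S

  Affine : Point S → Set
  Affine w = ¬ x ~ w

  Symmetry : Aut S → Set
  Symmetry = IsSymmetry S x

  FixesPoints : Line S → Aut S → Set
  FixesPoints N g = ∀ y → y ∈ N → g · y ≡ y

  0<s : 0 < s
  0<s = ≤-trans (s≤s z≤n) (proj₁ thick)

  0<t : 0 < t
  0<t = ≤-trans (s≤s z≤n) (proj₂ thick)

  s₀ : Fin s
  s₀ = Fin.fromℕ< 0<s

  t₀ t₁ : Fin t
  t₀ = Fin.fromℕ< 0<t
  t₁ = Fin.fromℕ< (proj₂ thick)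

  t₀≢t₁ : t₀ ≢ t₁
  t₀≢t₁ e with () ← trans (sym (Fin.toℕ-fromℕ< 0<t)) (trans (cong toℕ e) (Fin.toℕ-fromℕ< (proj₂ thick)))

  pointsExcept : ∀ {a L} → a ∈ L → Enumeration ((λ p → inc p L) ∖ a) s
  pointsExcept {L = L} a∈L = enumerate∖ (λ p → inc p L) a∈L (linePts L)

  linesExcept : ∀ {p N} → p ∈ N → Enumeration ((λ L → inc p L) ∖ N) t
  linesExcept {p = p} p∈N = enumerate∖ (inc p) p∈N (ptLines p)

  ~-sym : ∀ {p q} → p ~ q → q ~ p
  ~-sym (L , p∈L , q∈L) = L , q∈L , p∈L

  onLine : ∀ {p q L} → p ∈ L → q ∈ L → p ~ q
  onLine p∈L q∈L = _ , p∈L , q∈L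

  collinear? : ∀ p q → Dec (p ~ q)
  collinear? p q = Fin.any? (λ L → (inc p L Bool.≟ true) ×-dec (inc q L Bool.≟ true))

  -- The uniqueness clause of the quadrangle axiom. Points are identified below by exhibiting both
  -- as the projection of `w` on `K`.
  noTriangle : ∀ {w y y′ K} → w ∉ K → y ∈ K → y′ ∈ K → w ~ y → w ~ y′ → y ≡ y′
  noTriangle {w} {K = K} w∉K y∈K y′∈K w~y w~y′ with gqAxiom w K w∉K
  ... | _ , _ , _ , only = trans (only _ y∈K w~y) (sym (only _ y′∈K w~y′))

  affine∉ : ∀ {w N} → Affine w → x ∈ N → w ∉ N
  affine∉ aff x∈N w∈N = aff (onLine x∈N w∈N)

  affine⇒x∉ : ∀ {w K} → Affine w → w ∈ K → x ∉ K
  affine⇒x∉ aff w∈K x∈K = aff (onLine x∈K w∈K)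

  affinePoint : ∀ {K} → x ∉ K → Σ (Point S) λ w → w ∈ K × Affine w
  affinePoint {K} x∉K with gqAxiom x K x∉K
  ... | r , r∈K , _ , only = at s₀ , proj₁ (∖-elim (λ p → inc p K) (holds s₀)) ,
        λ x~w → proj₂ (∖-elim (λ p → inc p K) (holds s₀)) (only _ (proj₁ (∖-elim (λ p → inc p K) (holds s₀))) x~w)
    where open Enumeration (pointsExcept r∈K)

  anotherLine : ∀ {w K} → w ∈ K → Σ (Line S) λ K′ → w ∈ K′ × K′ ≢ K
  anotherLine {w} w∈K = at t₀ , ∖-elim (inc w) (holds t₀)
    where open Enumeration (linesExcept w∈K)

  toward : ∀ {w N} → Affine w → x ∈ N →
           Σ (Point S) λ y → Σ (Line S) λ K → y ∈ N × y ≢ x × w ∈ K × y ∈ K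
  toward {w} {N} aff x∈N with gqAxiom w N (affine∉ aff x∈N)
  ... | y , y∈N , (K , w∈K , y∈K) , _ = y , K , y∈N , y≢x , w∈K , y∈K
    where
    y≢x : y ≢ x
    y≢x refl = affine⇒x∉ aff w∈K y∈K

  meetAtX : ∀ {N N′ y} → x ∈ N → x ∈ N′ → N ≢ N′ → y ∈ N → y ∈ N′ → y ≡ x
  meetAtX x∈N x∈N′ N≢N′ y∈N y∈N′ = twoLines _ _ _ _ N≢N′ y∈N x∈N y∈N′ x∈N′

  ∈-map : ∀ g {p L} → p ∈ L → g · p ∈ g ∙ L
  ∈-map g p∈L = trans (presI g _ _) p∈L

  ∈-unmap : ∀ g {p L} → g · p ∈ g ∙ L → p ∈ L
  ∈-unmap g gp∈gL = trans (sym (presI g _ _)) gp∈gL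

  ~-map : ∀ g {p q} → p ~ q → g · p ~ g · q
  ~-map g (L , p∈L , q∈L) = g ∙ L , ∈-map g p∈L , ∈-map g q∈L

  ·-injective : ∀ g {p q} → g · p ≡ g · q → p ≡ q
  ·-injective g {p} {q} e = trans (sym (ptInvˡ g p)) (trans (cong (ptInv g) e) (ptInvˡ g q))

  ∙-injective : ∀ g {K L} → g ∙ K ≡ g ∙ L → K ≡ L
  ∙-injective g {K} {L} e = trans (sym (lnInvˡ g K)) (trans (cong (lnInv g) e) (lnInvˡ g L))

  ≐-sym : ∀ {g h} → g ≐ h → h ≐ g
  ≐-sym (e , e′) = (λ p → sym (e p)) , (λ L → sym (e′ L))

  ≐-trans : ∀ {f g h} → f ≐ g → g ≐ h → f ≐ h
  ≐-trans (e , e′) (d , d′) = (λ p → trans (e p) (d p)) , (λ L → trans (e′ L) (d′ L))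

  abstract
    linesThroughX : Enumeration (inc x) (suc t)
    linesThroughX = subst (Enumeration (inc x)) (trans (sym (countF≡∑ (inc x))) (ptLines x)) (enumerate (inc x))

  -- Two different lines through `x` are mapped to themselves, and they meet only in `x`.
  fixesX : ∀ {g} → H g → g · x ≡ x
  fixesX {g} Hg = meetAtX (holds zero) (holds (suc t₀)) N≢N′ (moved zero) (moved (suc t₀))
    where
    open Enumeration linesThroughX
    N≢N′ : at zero ≢ at (suc t₀)
    N≢N′ e with () ← injective zero (suc t₀) e
    moved : ∀ i → g · x ∈ at i
    moved i = subst (g · x ∈_) (fixLines g Hg (at i) (holds i)) (∈-map g (holds i))

  ~x-map : ∀ {g y} → H g → x ~ y → x ~ g · y
  ~x-map {g} {y} Hg x~y = subst (_~ g · y) (fixesX Hg) (~-map g x~y)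

  ∈x-map : ∀ {g y N} → H g → x ∈ N → y ∈ N → g · y ∈ N
  ∈x-map {g} {y} Hg x∈N y∈N = subst (g · y ∈_) (fixLines g Hg _ x∈N) (∈-map g y∈N)

  x∉-map : ∀ {g K} → H g → x ∉ K → x ∉ g ∙ K
  x∉-map {g} {K} Hg x∉K x∈gK = x∉K (∈-unmap g (subst (_∈ g ∙ K) (sym (fixesX Hg)) x∈gK))

  affine-map : ∀ {g v} → H g → Affine v → Affine (g · v)
  affine-map {g} {v} Hg aff x~gv = aff (subst₂ _~_
    (trans (cong (ptInv g) (sym (fixesX Hg))) (ptInvˡ g x)) (ptInvˡ g v) (~-map (g ⁻¹) x~gv))

  -- Let w be an affine point of K and r the point collinear with x on another line
  -- through w. The images of r and K determine the image of w, and H acts sharply.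
  agree⇒≐ : ∀ {g h K} → H g → H h → (∀ y → x ~ y → g · y ≡ h · y) →
            x ∉ K → g ∙ K ≡ h ∙ K → g ≐ h
  agree⇒≐ {g} {h} {K} Hg Hh agree x∉K gK≡hK
    with affinePoint x∉K
  ... | w , w∈K , aff with anotherLine w∈K
  ... | K′ , w∈K′ , K′≢K with gqAxiom x K′ (affine⇒x∉ aff w∈K′)
  ... | r , r∈K′ , x~r , _ = sharp w g h aff Hg Hh
    (noTriangle {g · r} {K = g ∙ K} (λ m → r∉K (∈-unmap g m)) (∈-map g w∈K)
      (subst (h · w ∈_) (sym gK≡hK) (∈-map h w∈K))
      (~-map g (onLine r∈K′ w∈K′))
      (subst (_~ h · w) (sym (agree r x~r)) (~-map h (onLine r∈K′ w∈K′))))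
    where
    r∉K : r ∉ K
    r∉K r∈K = K′≢K (twoPts r w K′ K (λ { refl → aff x~r }) r∈K′ w∈K′ r∈K w∈K)

  -- By `agree⇒≐` the `t` symmetries have different images of `K`. There are exactly `t` affine
  -- lines through `y`, so every one of them is reached.
  symmetry-transitive : ∀ {y K K′} → x ~ y → y ≢ x → x ∉ K → x ∉ K′ → y ∈ K → y ∈ K′ →
    Σ (Fin t) λ i → proj₁ syms i ∙ K ≡ K′
  symmetry-transitive {y} {K} {K′} x~y@(N , x∈N , y∈N) y≢x x∉K x∉K′ y∈K y∈K′
    = proj₁ hit , trans (sym (at-φ (proj₁ hit))) (trans (cong at (proj₂ hit)) (proj₂ target))
    where
    open Enumeration (linesExcept y∈N)
    σ : Fin t → Aut S
    σ = proj₁ syms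
    Hσ : ∀ i → H (σ i)
    Hσ = proj₁ (proj₂ syms)
    σ-sym : ∀ i → Symmetry (σ i)
    σ-sym = proj₁ (proj₂ (proj₂ syms))
    member : ∀ i → (inc y ∖ N) (σ i ∙ K) ≡ true
    member i = ∖-intro (inc y) (subst (_∈ σ i ∙ K) (σ-sym i y x~y) (∈-map (σ i) y∈K))
      (λ e → x∉-map (Hσ i) x∉K (subst (x ∈_) (sym e) x∈N))
    φ : Fin t → Fin t
    φ i = proj₁ (index (σ i ∙ K) (member i))
    at-φ : ∀ i → at (φ i) ≡ σ i ∙ K
    at-φ i = proj₂ (index (σ i ∙ K) (member i))
    φ-injective : ∀ i j → φ i ≡ φ j → i ≡ j
    φ-injective i j e with i Fin.≟ j
    ... | yes i≡j = i≡j
    ... | no i≢j = contradiction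
      (agree⇒≐ (Hσ i) (Hσ j) (λ v x~v → trans (σ-sym i v x~v) (sym (σ-sym j v x~v))) x∉K
        (trans (sym (at-φ i)) (trans (cong at e) (at-φ j))))
      (proj₁ (proj₂ (proj₂ (proj₂ syms))) i j i≢j)
    target : Σ (Fin t) λ k → at k ≡ K′
    target = index K′ (∖-intro (inc y) y∈K′ (λ { refl → x∉K′ x∈N }))
    hit : Σ (Fin t) λ i → φ i ≡ proj₁ target
    hit = injective⇒surjective φ φ-injective (proj₁ target)

  symmetry-between : ∀ {y K K′} → x ~ y → y ≢ x → x ∉ K → x ∉ K′ → y ∈ K → y ∈ K′ →
    Σ (Aut S) λ σ → H σ × Symmetry σ × σ ∙ K ≡ K′
  symmetry-between x~y y≢x x∉K x∉K′ y∈K y∈K′ with symmetry-transitive x~y y≢x x∉K x∉K′ y∈K y∈K′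
  ... | i , e = proj₁ syms i , proj₁ (proj₂ syms) i , proj₁ (proj₂ (proj₂ syms)) i , e

  -- Property (*) enters the argument here.
  fixesOne⇒fixesPoints : ∀ {g y N} → H g → x ∈ N → y ∈ N → y ≢ x → g · y ≡ y → FixesPoints N g
  fixesOne⇒fixesPoints {g} {y} {N} Hg x∈N y∈N y≢x gy≡y v v∈N =
    star g Hg y y≢x (onLine x∈N y∈N) gy≡y N x∈N y∈N v v∈N

  module _ {z : Point S} (z-affine : Affine z) where

    -- Let `K` join `z` to a point `y` of `N`, and let `σ` be a symmetry with the same image of `K`
    -- as `g`. Both `σ · z` and `g · z` are the point of that image collinear with `y′`, a point of
    -- `N′` fixed by both maps. Hence they are equal, and `σ ≐ g` by sharpness.
    fixesTwo⇒symmetry : ∀ {g N N′} → x ∈ N → x ∈ N′ → N ≢ N′ → H g →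
      FixesPoints N g → FixesPoints N′ g → Symmetry g
    fixesTwo⇒symmetry {g} {N} {N′} x∈N x∈N′ N≢N′ Hg fixN fixN′ with toward z-affine x∈N | toward z-affine x∈N′
    ... | y , K , y∈N , y≢x , z∈K , y∈K | y′ , K′ , y′∈N′ , y′≢x , z∈K′ , y′∈K′
      with symmetry-between (onLine x∈N y∈N) y≢x (affine⇒x∉ z-affine z∈K)
             (x∉-map Hg (affine⇒x∉ z-affine z∈K)) y∈K (subst (_∈ g ∙ K) (fixN y y∈N) (∈-map g y∈K))
    ... | σ , Hσ , σ-sym , σK≡gK = λ v x~v → trans (sym (proj₁ σ≐g v)) (σ-sym v x~v)
      where
      y′∉gK : y′ ∉ g ∙ K
      y′∉gK y′∈gK = y≢x (meetAtX x∈N x∈N′ N≢N′ y∈N (subst (_∈ N′)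
        (noTriangle (x∉-map Hg (affine⇒x∉ z-affine z∈K)) y′∈gK (subst (_∈ g ∙ K) (fixN y y∈N) (∈-map g y∈K))
          (onLine x∈N′ y′∈N′) (onLine x∈N y∈N))
        y′∈N′))
      σz≡gz : σ · z ≡ g · z
      σz≡gz = noTriangle {y′} y′∉gK (subst (σ · z ∈_) σK≡gK (∈-map σ z∈K)) (∈-map g z∈K)
        (subst (_~ σ · z) (σ-sym y′ (onLine x∈N′ y′∈N′)) (~-map σ (onLine y′∈K′ z∈K′)))
        (subst (_~ g · z) (fixN′ y′ y′∈N′) (~-map g (onLine y′∈K′ z∈K′)))
      σ≐g : σ ≐ g
      σ≐g = sharp z σ g z-affine Hσ Hg σz≡gz

    agreeOnTwo : ∀ {b c N N′} → x ∈ N → x ∈ N′ → N ≢ N′ → H b → H c →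
      (∀ y → y ∈ N → b · y ≡ c · y) → (∀ y → y ∈ N′ → b · y ≡ c · y) → ∀ y → x ~ y → b · y ≡ c · y
    agreeOnTwo {b} {c} x∈N x∈N′ N≢N′ Hb Hc onN onN′ y x~y = trans (sym (ptInvʳ c (b · y))) (cong (c ·_)
      (fixesTwo⇒symmetry x∈N x∈N′ N≢N′ (hasComp (c ⁻¹) b (hasInv c Hc) Hb)
        (λ v v∈N → trans (cong (ptInv c) (onN v v∈N)) (ptInvˡ c v))
        (λ v v∈N′ → trans (cong (ptInv c) (onN′ v v∈N′)) (ptInvˡ c v)) y x~y))

    -- The factor `n` has to fix `p₂` and to agree with `h` at `p₁`. For this it moves `z` to the
    -- point `w` of `K₂` collinear with `h · p₁`: the projections of `z` on `N₁` and `N₂` then go to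
    -- those of `w`, which are `h · p₁` and `p₂`.
    factor : ∀ {N₁ N₂ h} → x ∈ N₁ → x ∈ N₂ → N₁ ≢ N₂ → H h →
      Σ (Aut S) λ n → H n × FixesPoints N₂ n × FixesPoints N₁ (n ⁻¹ ∘ᴬ h)
    factor {N₁} {N₂} {h} x∈N₁ x∈N₂ N₁≢N₂ Hh with toward z-affine x∈N₁ | toward z-affine x∈N₂
    ... | p₁ , K₁ , p₁∈N₁ , p₁≢x , z∈K₁ , p₁∈K₁ | p₂ , K₂ , p₂∈N₂ , p₂≢x , z∈K₂ , p₂∈K₂
      with gqAxiom (h · p₁) K₂ hp₁∉K₂
      where
      hp₁∉K₂ : h · p₁ ∉ K₂
      hp₁∉K₂ hp₁∈K₂ = p₂≢x (meetAtX x∈N₁ x∈N₂ N₁≢N₂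
        (subst (_∈ N₁) (noTriangle (affine⇒x∉ z-affine z∈K₂) hp₁∈K₂ p₂∈K₂
                          (onLine x∈N₁ (∈x-map Hh x∈N₁ p₁∈N₁)) (onLine x∈N₂ p₂∈N₂))
          (∈x-map Hh x∈N₁ p₁∈N₁)) p₂∈N₂)
    ... | w , w∈K₂ , hp₁~w , _ = n , Hn , fixesOne⇒fixesPoints Hn x∈N₂ p₂∈N₂ p₂≢x np₂≡p₂ ,
          fixesOne⇒fixesPoints (hasComp (n ⁻¹) h (hasInv n Hn) Hh) x∈N₁ p₁∈N₁ p₁≢x
            (trans (cong (ptInv n) (sym np₁≡hp₁)) (ptInvˡ n p₁))
      where
      hp₁∈N₁ : h · p₁ ∈ N₁
      hp₁∈N₁ = ∈x-map Hh x∈N₁ p₁∈N₁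
      p₂∉N₁ : p₂ ∉ N₁
      p₂∉N₁ p₂∈N₁ = p₂≢x (meetAtX x∈N₁ x∈N₂ N₁≢N₂ p₂∈N₁ p₂∈N₂)
      -- Otherwise `w` would be `p₂`, which would then be collinear with two points of `N₁`, namely
      -- `x` and `h · p₁`.
      w-affine : Affine w
      w-affine x~w = p₁≢x (·-injective h (trans
        (noTriangle p₂∉N₁ hp₁∈N₁ x∈N₁
          (subst (_~ h · p₁) (noTriangle (affine⇒x∉ z-affine z∈K₂) w∈K₂ p₂∈K₂ x~w (onLine x∈N₂ p₂∈N₂)) (~-sym hp₁~w))
          (onLine p₂∈N₂ x∈N₂))
        (sym (fixesX Hh))))
      moved : Σ (Aut S) λ n → H n × n · z ≡ w
      moved = transitive z w z-affine w-affine
      n : Aut S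
      n = proj₁ moved
      Hn : H n
      Hn = proj₁ (proj₂ moved)
      nz≡w : n · z ≡ w
      nz≡w = proj₂ (proj₂ moved)
      np₁≡hp₁ : n · p₁ ≡ h · p₁
      np₁≡hp₁ = noTriangle (affine∉ w-affine x∈N₁) (∈x-map Hn x∈N₁ p₁∈N₁) hp₁∈N₁
        (subst (_~ n · p₁) nz≡w (~-map n (onLine z∈K₁ p₁∈K₁))) (~-sym hp₁~w)
      np₂≡p₂ : n · p₂ ≡ p₂
      np₂≡p₂ = noTriangle (affine∉ w-affine x∈N₂) (∈x-map Hn x∈N₂ p₂∈N₂) p₂∈N₂
        (subst (_~ n · p₂) nz≡w (~-map n (onLine z∈K₂ p₂∈K₂))) (onLine w∈K₂ p₂∈K₂)

    -- On `N` both products act as `m` alone, on `N′` both act as `a` alone, and two lines through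
    -- `x` suffice by `agreeOnTwo`.
    commuteAcross : ∀ {a m N N′} → x ∈ N → x ∈ N′ → N ≢ N′ → H a → H m →
      FixesPoints N a → FixesPoints N′ m → ∀ y → x ~ y → a · m · y ≡ m · a · y
    commuteAcross {a} {m} x∈N x∈N′ N≢N′ Ha Hm fixN fixN′ =
      agreeOnTwo x∈N x∈N′ N≢N′ (hasComp a m Ha Hm) (hasComp m a Hm Ha)
        (λ y y∈N → trans (fixN _ (∈x-map Hm x∈N y∈N)) (cong (m ·_) (sym (fixN y y∈N))))
        (λ y y∈N′ → trans (cong (a ·_) (fixN′ y y∈N′)) (sym (fixN′ _ (∈x-map Ha x∈N′ y∈N′))))

    -- H is generated by the pointwise stabilizers of any two lines through x, and those
    -- of different lines commute on the points collinear with x.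
    commuteNearX : ∀ {a h N} → x ∈ N → H a → H h → FixesPoints N a →
      ∀ y → x ~ y → a · h · y ≡ h · a · y
    commuteNearX {a} {h} {N} x∈N Ha Hh fixN y x~y = begin
      a · h · y         ≡⟨ cong (a ·_) (ptInvʳ n (h · y)) ⟨
      a · n · m · y     ≡⟨ commuteAcross x∈N x∈N₂ N≢N₂ Ha Hn fixN n-fix (m · y) (~x-map Hm x~y) ⟩
      n · a · m · y     ≡⟨ cong (n ·_) (commuteAcross x∈N x∈N₁ N≢N₁ Ha Hm fixN m-fix y x~y) ⟩
      n · m · a · y     ≡⟨ ptInvʳ n (h · a · y) ⟩
      h · a · y         ∎
      where
      open ≡-Reasoning
      open Enumeration (linesExcept x∈N)
      -- Since `t` is at least 2, two lines through `x` other than `N` are available.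
      N₁ N₂ : Line S
      N₁ = at t₀
      N₂ = at t₁
      x∈N₁ : x ∈ N₁
      x∈N₁ = proj₁ (∖-elim (inc x) (holds t₀))
      x∈N₂ : x ∈ N₂
      x∈N₂ = proj₁ (∖-elim (inc x) (holds t₁))
      N≢N₁ : N ≢ N₁
      N≢N₁ = proj₂ (∖-elim (inc x) (holds t₀)) ∘ sym
      N≢N₂ : N ≢ N₂
      N≢N₂ = proj₂ (∖-elim (inc x) (holds t₁)) ∘ sym
      factored : Σ (Aut S) λ n → H n × FixesPoints N₂ n × FixesPoints N₁ (n ⁻¹ ∘ᴬ h)
      factored = factor x∈N₁ x∈N₂ (t₀≢t₁ ∘ injective t₀ t₁) Hh
      n m : Aut S
      n = proj₁ factored
      m = n ⁻¹ ∘ᴬ h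
      Hn : H n
      Hn = proj₁ (proj₂ factored)
      Hm : H m
      Hm = hasComp (n ⁻¹) h (hasInv n Hn) Hh
      n-fix : FixesPoints N₂ n
      n-fix = proj₁ (proj₂ (proj₂ factored))
      m-fix : FixesPoints N₁ m
      m-fix = proj₂ (proj₂ (proj₂ factored))

-- Benson's lemma

ι-idem : ∀ b → ι b * ι b ≡ ι b
ι-idem true  = refl
ι-idem false = refl

-- Put `w = s * t`. As `ℓ` divides `s + t`, the product `suc t * suc s` is congruent to `w + 1`, and
-- the hypothesis says that `2w + 1` is congruent to the square of `w + 1`. So `ℓ` divides `w * w`,
-- hence `s` or `t`, and then `s` in either case.
bensonArithmetic : ∀ {ℓ s t} → Prime ℓ → ℓ ∣ s + t →
  suc t * suc s + s * t ≈ (suc t * suc s) * (suc t * suc s) [mod ℓ ] → ℓ ∣ s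
bensonArithmetic {ℓ} {s} {t} pr ℓ∣s+t trace = conclude (euclidsLemma s t pr ℓ∣st)
  where
  expandProduct : ∀ s t → suc t * suc s ≡ s * t + 1 + (s + t)
  expandProduct = solve-∀
  expandSquare : ∀ w → w * w + (w + 1 + w) ≡ (w + 1) * (w + 1)
  expandSquare = solve-∀
  square≈0 : ∀ w r → r ≈ w + 1 [mod ℓ ] → r + w ≈ r * r [mod ℓ ] → w * w ≈ 0 [mod ℓ ]
  square≈0 w r r≈w+1 r+w≈r² = ≈-+-cancelʳ (w + 1 + w) (≈-trans (≈-reflexive (expandSquare w))
    (≈-trans (≈-sym r²≈) (≈-trans (≈-sym r+w≈r²) (≈-+ r≈w+1 (≈-reflexive {a = w} refl)))))
    where
    r²≈ : r * r ≈ (w + 1) * (w + 1) [mod ℓ ]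
    r²≈ = ≈-trans (≈-*ˡ r r≈w+1) (≈-trans (≈-reflexive (*-comm r (w + 1))) (≈-*ˡ (w + 1) r≈w+1))
  product≈ : suc t * suc s ≈ s * t + 1 [mod ℓ ]
  product≈ = ≈-trans (≈-reflexive (expandProduct s t))
    (≈-trans (≈-+ (≈-reflexive {a = s * t + 1} refl) (∣⇒≈0 ℓ∣s+t)) (≈-reflexive (+-identityʳ (s * t + 1))))
  ℓ∣st : ℓ ∣ s * t
  ℓ∣st = [ id , id ]′ (euclidsLemma (s * t) (s * t) pr (≈0⇒∣ (square≈0 (s * t) (suc t * suc s) product≈ trace)))
  conclude : ℓ ∣ s ⊎ ℓ ∣ t → ℓ ∣ s
  conclude (inj₁ ℓ∣s) = ℓ∣s
  conclude (inj₂ ℓ∣t) = ∣m+n∣m⇒∣n (subst (ℓ ∣_) (+-comm s t) ℓ∣s+t) ℓ∣t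

-- Benson's lemma modulo a prime divisor of s + t: T is the product of the incidence
-- matrix, the permutation matrix of g and the transposed incidence matrix, and modulo ℓ
-- the entries of T² do not depend on g, hence neither does the trace of T^ℓ ≡ tr T.
module Benson (S : IncStr) (s t : ℕ) (gq : IsGQ S s t) where
  open IncStr S
  open IsGQ gq

  b : Point S → Line S → ℕ
  b p L = ι (inc p L)

  ∑-points : ∀ L → ∑[ p < np ] b p L ≡ suc s
  ∑-points L = trans (sym (countF≡∑ (λ p → inc p L))) (linePts L)

  ∑-lines : ∀ p → ∑[ L < nl ] b p L ≡ suc t
  ∑-lines p = trans (sym (countF≡∑ (inc p))) (ptLines p)

  joins : Point S → Point S → ℕ
  joins v u = ∑[ L < nl ] (b v L * b u L)

  joins-refl : ∀ u → joins u u ≡ suc t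
  joins-refl u = trans (sum-cong-≗ (λ L → ι-idem (inc u L))) (∑-lines u)

  joins-~ : ∀ {u v L} → v ≢ u → inc v L ≡ true → inc u L ≡ true → joins v u ≡ 1
  joins-~ {u} {v} {L} v≢u v∈L u∈L = trans
    (sum-cong-≗ (λ M → sym (ι-∧ (inc v M) (inc u M))))
    (∑ι-unique (λ M → inc v M ∧ inc u M) L (∧-true v∈L u∈L)
      (λ M e → twoPts v u M L v≢u (∧-trueˡ e) (∧-trueʳ {inc v M} e) v∈L u∈L))

  joins-≁ : ∀ {u v} → ¬ Collinear S u v → joins v u ≡ 0
  joins-≁ {u} {v} u≁v = ∑-zero (λ M → trans (sym (ι-∧ (inc v M) (inc u M)))
    (cong ι (≢true (λ e → u≁v (M , ∧-trueʳ {inc v M} e , ∧-trueˡ e)))))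

  -- If `u` lies on `K`, it contributes `suc t` itself and each of the `s` other points contributes
  -- 1. If not, only the projection of `u` on `K` is joined to `u`, by one line.
  pointsJoined : ∀ u K → ∑[ v < np ] (b v K * joins v u) ≡ 1 + (s + t) * b u K
  pointsJoined u K with inc u K in eq
  ... | true  = begin
    ∑[ v < np ] (b v K * joins v u)                         ≡⟨ sum-cong-≗ term ⟩
    ∑[ v < np ] (b v K + t * ι (does (v Fin.≟ u)))          ≡⟨ ∑-distrib-+ (λ v → b v K) _ ⟩
    sum (λ v → b v K) + ∑[ v < np ] (t * ι (does (v Fin.≟ u)))
      ≡⟨ cong₂ _+_ (∑-points K) (sym (*-distribˡ-sum t (λ v → ι (does (v Fin.≟ u))))) ⟩
    suc s + t * ∑[ v < np ] ι (does (v Fin.≟ u))            ≡⟨ cong (λ k → suc s + t * k) (∑ι-≟ u) ⟩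
    suc s + t * 1                                           ≡⟨ arith s t ⟩
    1 + (s + t) * 1                                         ∎
    where
    open ≡-Reasoning
    arith : ∀ s t → suc s + t * 1 ≡ 1 + (s + t) * 1
    arith = solve-∀
    term : ∀ v → b v K * joins v u ≡ b v K + t * ι (does (v Fin.≟ u))
    term v with v Fin.≟ u
    ... | yes refl rewrite eq | joins-refl u = trans (+-identityʳ (suc t)) (cong suc (sym (*-identityʳ t)))
    ... | no v≢u with inc v K in v∈K
    ...   | true  rewrite joins-~ v≢u v∈K eq = cong suc (sym (*-zeroʳ t))
    ...   | false = sym (*-zeroʳ t)
  ... | false with gqAxiom u K (λ e → contradiction (trans (sym e) eq) λ ())
  ...   | q , q∈K , (M , u∈M , q∈M) , only = trans
    (∑-single _ q other)
    (trans (cong₂ _*_ (cong ι q∈K) (joins-~ q≢u q∈M u∈M)) (cong suc (sym (*-zeroʳ (s + t)))))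
    where
    q≢u : q ≢ u
    q≢u refl = contradiction (trans (sym q∈K) eq) λ ()
    other : ∀ v → v ≢ q → b v K * joins v u ≡ 0
    other v v≢q with inc v K in v∈K
    ... | false = refl
    ... | true  = trans (+-identityʳ _) (joins-≁ (λ u~v → v≢q (only v v∈K u~v)))

  r : ℕ
  r = suc t * suc s

  module _ (g : Aut S) where

    T : Line S → Line S → ℕ
    T L L′ = ∑[ v < np ] (b v L′ * b (pt g v) L)

    b-image : ∀ L v → b (pt g v) L ≡ b v (lnInv g L)
    b-image L v = cong ι (trans (cong (inc (pt g v)) (sym (lnInvʳ g L))) (presI g v (lnInv g L)))

    ∑-points-image : ∀ L → ∑[ v < np ] b (pt g v) L ≡ suc s
    ∑-points-image L = trans (sum-cong-≗ (b-image L)) (∑-points (lnInv g L))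

    T-rows : ∀ L → ∑[ L′ < nl ] T L L′ ≡ r
    T-rows L = begin
      ∑[ L′ < nl ] ∑[ v < np ] (b v L′ * b (pt g v) L)   ≡⟨ ∑-comm (λ L′ v → b v L′ * b (pt g v) L) ⟩
      ∑[ v < np ] ∑[ L′ < nl ] (b v L′ * b (pt g v) L)
        ≡⟨ sum-cong-≗ (λ v → sym (*-distribʳ-sum (b (pt g v) L) (b v))) ⟩
      ∑[ v < np ] (sum (b v) * b (pt g v) L)
        ≡⟨ sum-cong-≗ (λ v → cong (_* b (pt g v) L) (∑-lines v)) ⟩
      ∑[ v < np ] (suc t * b (pt g v) L)                 ≡⟨ *-distribˡ-sum (suc t) (λ v → b (pt g v) L) ⟨
      suc t * ∑[ v < np ] b (pt g v) L                   ≡⟨ cong (suc t *_) (∑-points-image L) ⟩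
      r                                                  ∎
      where open ≡-Reasoning

    -- Summing over `L′` first counts the lines joining `g · w` to the points of the preimage of
    -- `L`. The part that depends on `g` carries the factor `s + t`, which vanishes modulo `ℓ`.
    T² : ∀ L L″ → ∑[ L′ < nl ] (T L L′ * T L′ L″) ≡
         ∑[ w < np ] (b w L″ * (1 + (s + t) * b (pt g w) (lnInv g L)))
    T² L L″ = begin
      ∑[ L′ < nl ] (T L L′ * T L′ L″)
        ≡⟨ sum-cong-≗ (λ L′ → *-distribˡ-sum (T L L′) (λ w → b w L″ * b (pt g w) L′)) ⟩
      ∑[ L′ < nl ] ∑[ w < np ] (T L L′ * (b w L″ * b (pt g w) L′))
        ≡⟨ ∑-comm (λ L′ w → T L L′ * (b w L″ * b (pt g w) L′)) ⟩
      ∑[ w < np ] ∑[ L′ < nl ] (T L L′ * (b w L″ * b (pt g w) L′))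
        ≡⟨ sum-cong-≗ (λ w → trans (sum-cong-≗ (λ L′ → swap (T L L′) (b w L″) (b (pt g w) L′)))
             (sym (*-distribˡ-sum (b w L″) (λ L′ → T L L′ * b (pt g w) L′)))) ⟩
      ∑[ w < np ] (b w L″ * ∑[ L′ < nl ] (T L L′ * b (pt g w) L′))
        ≡⟨ sum-cong-≗ (λ w → cong (b w L″ *_) (inner (pt g w))) ⟩
      ∑[ w < np ] (b w L″ * (1 + (s + t) * b (pt g w) (lnInv g L))) ∎
      where
      open ≡-Reasoning
      swap : ∀ x y z → x * (y * z) ≡ y * (x * z)
      swap = solve-∀
      swap′ : ∀ x y z → x * y * z ≡ y * (x * z)
      swap′ = solve-∀
      inner : ∀ u → ∑[ L′ < nl ] (T L L′ * b u L′) ≡ 1 + (s + t) * b u (lnInv g L)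
      inner u = begin
        ∑[ L′ < nl ] (T L L′ * b u L′)
          ≡⟨ sum-cong-≗ (λ L′ → *-distribʳ-sum (b u L′) (λ v → b v L′ * b (pt g v) L)) ⟩
        ∑[ L′ < nl ] ∑[ v < np ] (b v L′ * b (pt g v) L * b u L′)
          ≡⟨ ∑-comm (λ L′ v → b v L′ * b (pt g v) L * b u L′) ⟩
        ∑[ v < np ] ∑[ L′ < nl ] (b v L′ * b (pt g v) L * b u L′)
          ≡⟨ sum-cong-≗ (λ v → trans (sum-cong-≗ (λ L′ → swap′ (b v L′) (b (pt g v) L) (b u L′)))
               (sym (*-distribˡ-sum (b (pt g v) L) (λ L′ → b v L′ * b u L′)))) ⟩
        ∑[ v < np ] (b (pt g v) L * joins v u)
          ≡⟨ sum-cong-≗ (λ v → cong (_* joins v u) (b-image L v)) ⟩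
        ∑[ v < np ] (b v (lnInv g L) * joins v u)
          ≡⟨ pointsJoined u (lnInv g L) ⟩
        1 + (s + t) * b u (lnInv g L) ∎

  module _ (m : ℕ) (prime : Prime (suc (suc m))) (ℓ∣s+t : suc (suc m) ∣ s + t) (N : Line S) where
    private
      ℓ : ℕ
      ℓ = suc (suc m)

    T²≈ : ∀ g L L″ → ∑[ L′ < nl ] (T g L L′ * T g L′ L″) ≈ suc s [mod ℓ ]
    T²≈ g L L″ = ≈-trans (≈-reflexive (T² g L L″)) (≈-trans
      (≈-∑ (λ w → ≈-*ˡ (b w L″) (≈-+ (≈-reflexive {a = 1} refl) (∣⇒≈0 (∣m⇒∣m*n (b (pt g w) (lnInv g L)) ℓ∣s+t)))))
      (≈-reflexive (trans (sum-cong-≗ (λ w → *-identityʳ (b w L″))) (∑-points L″))))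

    -- For the identity, the row of the squared matrix at `N` has sum `r * r`, and each of its `nl`
    -- entries is congruent to `suc s`.
    lines≈ : nl * suc s ≈ r * r [mod ℓ ]
    lines≈ = ≈-trans (≈-reflexive (sym (∑-const nl (suc s))))
      (≈-trans (≈-∑ (λ L″ → ≈-sym (T²≈ 1A N L″))) (≈-reflexive rows²))
      where
      open ≡-Reasoning
      1A : Aut S
      1A = idA S
      rows² : ∑[ L″ < nl ] ∑[ L′ < nl ] (T 1A N L′ * T 1A L′ L″) ≡ r * r
      rows² = begin
        ∑[ L″ < nl ] ∑[ L′ < nl ] (T 1A N L′ * T 1A L′ L″) ≡⟨ ∑-comm (λ L″ L′ → T 1A N L′ * T 1A L′ L″) ⟩
        ∑[ L′ < nl ] ∑[ L″ < nl ] (T 1A N L′ * T 1A L′ L″)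
          ≡⟨ sum-cong-≗ (λ L′ → sym (*-distribˡ-sum (T 1A N L′) (T 1A L′))) ⟩
        ∑[ L′ < nl ] (T 1A N L′ * sum (T 1A L′))
          ≡⟨ sum-cong-≗ (λ L′ → cong (T 1A N L′ *_) (T-rows 1A L′)) ⟩
        ∑[ L′ < nl ] (T 1A N L′ * r)                       ≡⟨ *-distribʳ-sum r (T 1A N) ⟨
        sum (T 1A N) * r                                   ≡⟨ cong (_* r) (T-rows 1A N) ⟩
        r * r                                              ∎

    -- The trace is congruent to that for the identity, which counts the incident point-line pairs.
    benson : ∀ g → ∑[ L < nl ] T g L L ≈ r * r [mod ℓ ]
    benson g = ≈-trans (Trace.trace m prime (T g) (T-rows g) (T²≈ g))
      (≈-trans (≈-sym (Trace.trace m prime (T (idA S)) (T-rows (idA S)) (T²≈ (idA S))))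
        (≈-trans (≈-reflexive trace1) lines≈))
      where
      trace1 : ∑[ L < nl ] T (idA S) L L ≡ nl * suc s
      trace1 = trans (sum-cong-≗ (λ L → trans (sum-cong-≗ (λ v → ι-idem (inc v L))) (∑-points L))) (∑-const nl (suc s))

-- Existence of fixed affine lines

module FixedLines (S : IncStr) (s t : ℕ) (x : Point S) (H : Aut S → Set)
  (gq : IsGQ S s t) (thick : Thick S s t)
  (egq : IsEGQ S x H) (syms : HasSymGroup S t x H) (star : PropStar S x H)
  {ℓ : ℕ} (prime : Prime ℓ) (ℓ∣s+t : ℓ ∣ s + t) (ℓ∤s : ¬ (ℓ ∣ s)) where

  open ElationGQ S s t x H gq thick egq syms star
  open Benson S s t gq using (b; T; benson; ∑-points)

  module _ {z : Point S} (z-affine : Affine z) {N : Line S} (x∈N : x ∈ N)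
           {g : Aut S} (Hg : H g) (fixN : FixesPoints N g) (¬sym : ¬ Symmetry g) where

    -- A fixed point on another line through `x` would make that line pointwise fixed by (*); with
    -- two such lines `g` would be a symmetry.
    fixed⇒∈N : ∀ {y} → x ~ y → y ≢ x → g · y ≡ y → y ∈ N
    fixed⇒∈N {y} (N′ , x∈N′ , y∈N′) y≢x gy≡y with N′ Fin.≟ N
    ... | yes refl = y∈N′
    ... | no N′≢N  = contradiction
      (fixesTwo⇒symmetry z-affine x∈N′ x∈N N′≢N Hg (fixesOne⇒fixesPoints Hg x∈N′ y∈N′ y≢x gy≡y) fixN) ¬sym

    -- If `v` is affine, let `r` be the projection of `x` on `L`. Both `r` and `g · r` are the
    -- projection of `g · v` on the line `x r`, so `r` is fixed and `L` too, a contradiction. If `v`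
    -- is collinear with `x`, then `v` and `g · v` are both that projection `r`, so `v` is fixed.
    meets⇒∈N : ∀ {v L} → x ∉ L → g ∙ L ≢ L → v ∈ L → g · v ∈ L → v ∈ N
    meets⇒∈N {v} {L} x∉L gL≢L v∈L gv∈L with collinear? x v
    ... | yes x~v@(N′ , x∈N′ , v∈N′) = fixed⇒∈N x~v (λ { refl → x∉L v∈L })
      (noTriangle x∉L gv∈L v∈L (~x-map Hg x~v) x~v)
    ... | no v-affine = contradiction (rest (gqAxiom x L x∉L)) gL≢L
      where
      gv-affine : Affine (g · v)
      gv-affine = affine-map Hg v-affine
      rest : (Σ (Point S) λ r → r ∈ L × x ~ r × (∀ r′ → r′ ∈ L → x ~ r′ → r′ ≡ r)) → g ∙ L ≡ L
      rest (r , r∈L , x~r@(N′ , x∈N′ , r∈N′) , _) =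
        twoPts (g · v) r (g ∙ L) L (λ e → gv-affine (subst (x ~_) (sym e) x~r)) (∈-map g v∈L)
          (subst (_∈ g ∙ L) gr≡r (∈-map g r∈L)) gv∈L r∈L
        where
        gr≡r : g · r ≡ r
        gr≡r = noTriangle (affine∉ gv-affine x∈N′) (∈x-map Hg x∈N′ r∈N′) r∈N′
          (~-map g (onLine v∈L r∈L)) (onLine gv∈L r∈L)

    -- Each of the `suc t` lines through `x` contributes all its points, each of the `s * t` affine
    -- lines meeting `N` only its point on `N`, and the remaining lines nothing.
    trace-if-noFixedLine : (∀ L → x ∉ L → g ∙ L ≢ L) →
      ∑[ L < nl ] T g L L ≡ suc t * suc s + s * t
    trace-if-noFixedLine noFixed = begin
      ∑[ L < nl ] ∑[ v < np ] (b v L * b (g · v) L)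
        ≡⟨ sum-cong-≗ (λ L → sum-cong-≗ (λ v → term v L)) ⟩
      ∑[ L < nl ] ∑[ v < np ] (b x L * b v L + ι ((inc[N] ∖ x) v) * ι ((inc v ∖ N) L))
        ≡⟨ sum-cong-≗ (λ L → ∑-distrib-+ (λ v → b x L * b v L) _) ⟩
      ∑[ L < nl ] (∑[ v < np ] (b x L * b v L) + ∑[ v < np ] (ι ((inc[N] ∖ x) v) * ι ((inc v ∖ N) L)))
        ≡⟨ ∑-distrib-+ (λ L → ∑[ v < np ] (b x L * b v L)) _ ⟩
      ∑[ L < nl ] ∑[ v < np ] (b x L * b v L) + ∑[ L < nl ] ∑[ v < np ] (ι ((inc[N] ∖ x) v) * ι ((inc v ∖ N) L))
        ≡⟨ cong₂ _+_ onX onN ⟩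
      suc t * suc s + s * t ∎
      where
      open ≡-Reasoning
      inc[N] : Point S → Bool
      inc[N] v = inc v N

      onX : ∑[ L < nl ] ∑[ v < np ] (b x L * b v L) ≡ suc t * suc s
      onX = begin
        ∑[ L < nl ] ∑[ v < np ] (b x L * b v L)
          ≡⟨ sum-cong-≗ (λ L → sym (*-distribˡ-sum (b x L) (λ v → b v L))) ⟩
        ∑[ L < nl ] (b x L * ∑[ v < np ] b v L) ≡⟨ sum-cong-≗ (λ L → cong (b x L *_) (∑-points L)) ⟩
        ∑[ L < nl ] (b x L * suc s)             ≡⟨ *-distribʳ-sum (suc s) (b x) ⟨
        sum (b x) * suc s                       ≡⟨ cong (_* suc s) (Benson.∑-lines S s t gq x) ⟩
        suc t * suc s                           ∎

      onN : ∑[ L < nl ] ∑[ v < np ] (ι ((inc[N] ∖ x) v) * ι ((inc v ∖ N) L)) ≡ s * t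
      onN = begin
        ∑[ L < nl ] ∑[ v < np ] (ι ((inc[N] ∖ x) v) * ι ((inc v ∖ N) L))
          ≡⟨ ∑-comm (λ L v → ι ((inc[N] ∖ x) v) * ι ((inc v ∖ N) L)) ⟩
        ∑[ v < np ] ∑[ L < nl ] (ι ((inc[N] ∖ x) v) * ι ((inc v ∖ N) L))
          ≡⟨ sum-cong-≗ (λ v → sym (*-distribˡ-sum (ι ((inc[N] ∖ x) v)) (λ L → ι ((inc v ∖ N) L)))) ⟩
        ∑[ v < np ] (ι ((inc[N] ∖ x) v) * ∑[ L < nl ] ι ((inc v ∖ N) L)) ≡⟨ sum-cong-≗ through ⟩
        ∑[ v < np ] (ι ((inc[N] ∖ x) v) * t)
          ≡⟨ *-distribʳ-sum t (λ v → ι ((inc[N] ∖ x) v)) ⟨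
        sum (ι ∘ (inc[N] ∖ x)) * t
          ≡⟨ cong (_* t) (∑-∖ inc[N] x∈N (∑-points N)) ⟩
        s * t                                                            ∎
        where
        through : ∀ v → ι ((inc[N] ∖ x) v) * ∑[ L < nl ] ι ((inc v ∖ N) L) ≡ ι ((inc[N] ∖ x) v) * t
        through v with (inc[N] ∖ x) v in eq
        ... | false = refl
        ... | true  = cong (1 *_) (∑-∖ (inc v) (proj₁ (∖-elim inc[N] {x} {v} eq)) (Benson.∑-lines S s t gq v))

      term : ∀ v L → b v L * b (g · v) L ≡ b x L * b v L + ι ((inc[N] ∖ x) v) * ι ((inc v ∖ N) L)
      term v L with inc x L in eq
      ... | true = trans (trans (sym (ι-∧ (inc v L) _)) (cong ι (⇔⇒≡ ∧-trueˡ (λ v∈L → ∧-true v∈L (∈x-map Hg eq v∈L)))))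
          (trans (sym (trans (+-identityʳ _) (+-identityʳ _))) (cong (1 * b v L +_) (sym none)))
        where
        none : ι ((inc[N] ∖ x) v) * ι ((inc v ∖ N) L) ≡ 0
        none = trans (sym (ι-∧ ((inc[N] ∖ x) v) _)) (cong ι (≢true λ e →
          let v∈N , v≢x = ∖-elim inc[N] {x} {v} (∧-trueˡ e)
              v∈L , L≢N = ∖-elim (inc v) {N} {L} (∧-trueʳ {(inc[N] ∖ x) v} e)
          in v≢x (meetAtX eq x∈N L≢N v∈L v∈N)))
      ... | false = trans (sym (ι-∧ (inc v L) _)) (trans (cong ι (⇔⇒≡ to from)) (ι-∧ ((inc[N] ∖ x) v) _))
        where
        x∉L : x ∉ L
        x∉L x∈L = contradiction (trans (sym x∈L) eq) λ ()
        to : inc v L ∧ inc (g · v) L ≡ true → (inc[N] ∖ x) v ∧ (inc v ∖ N) L ≡ true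
        to e = ∧-true
          (∖-intro inc[N] (meets⇒∈N x∉L (noFixed L x∉L) (∧-trueˡ e) (∧-trueʳ {inc v L} e)) (λ { refl → x∉L (∧-trueˡ e) }))
          (∖-intro (inc v) (∧-trueˡ e) (λ { refl → x∉L x∈N }))
        from : (inc[N] ∖ x) v ∧ (inc v ∖ N) L ≡ true → inc v L ∧ inc (g · v) L ≡ true
        from e =
          let v∈N , _ = ∖-elim inc[N] {x} {v} (∧-trueˡ e)
              v∈L , _ = ∖-elim (inc v) {N} {L} (∧-trueʳ {(inc[N] ∖ x) v} e)
          in ∧-true v∈L (subst (_∈ L) (sym (fixN v v∈N)) v∈L)

    -- Without a fixed affine line the trace would contradict Benson's congruence, as `ℓ` does not
    -- divide `s`. On a fixed line the point collinear with `x` is fixed, so it lies on `N`.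
    fixedLine : Σ (Line S) λ M → x ∉ M × g ∙ M ≡ M × Σ (Point S) λ y → y ∈ M × y ∈ N × y ≢ x
    fixedLine with Fin.any? (λ M → ¬? (inc x M Bool.≟ true) ×-dec (g ∙ M Fin.≟ M))
    ... | yes (M , x∉M , gM≡M) with gqAxiom x M x∉M
    ...   | r , r∈M , x~r , only = M , x∉M , gM≡M , r , r∈M ,
            fixed⇒∈N x~r (λ { refl → x∉M r∈M }) (only _ (subst (g · r ∈_) gM≡M (∈-map g r∈M)) (~x-map Hg x~r)) ,
            (λ { refl → x∉M r∈M })
    fixedLine | no none with prime⇒2+ prime
    ... | m , refl = contradiction
      (bensonArithmetic prime ℓ∣s+t (≈-trans (≈-reflexive (sym (trace-if-noFixedLine (λ L x∉L gL≡L → none (L , x∉L , gL≡L)))))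
        (benson m prime ℓ∣s+t N g)))
      ℓ∤s

-- The stabilizer of an affine line

distinctPrimes⇒coprime : ∀ {ℓ q} → Prime ℓ → Prime q → ℓ ≢ q → Coprime ℓ q
distinctPrimes⇒coprime pr pr′ ℓ≢q (d∣ℓ , d∣q) with prime⇒irreducible pr d∣ℓ
... | inj₁ d≡1 = d≡1
... | inj₂ refl with prime⇒irreducible pr′ d∣q
...   | inj₁ d≡1 = d≡1
...   | inj₂ d≡q = contradiction d≡q ℓ≢q

module LineStabilizer (S : IncStr) (s t : ℕ) (x : Point S) (H : Aut S → Set)
  (gq : IsGQ S s t) (thick : Thick S s t)
  (egq : IsEGQ S x H) (syms : HasSymGroup S t x H) (star : PropStar S x H)
  (L : Line S) (x∉L : ¬ (_I_ S x L)) (elementary : ElemAbelian S (Stab S H L))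
  (p : Point S) (p∈L : _I_ S p L) (N : Line S) (x∈N : _I_ S x N) (p∈N : _I_ S p N) where

  open ElationGQ S s t x H gq thick egq syms star

  A : Aut S → Set
  A = Stab S H L

  A-commutes : ∀ {g h} → A g → A h → g ∘ᴬ h ≐ h ∘ᴬ g
  A-commutes Ag Ah = proj₁ elementary _ _ Ag Ah

  A-comp : ∀ {g h} → A g → A h → A (g ∘ᴬ h)
  A-comp {g} {h} (Hg , gL) (Hh , hL) = hasComp g h Hg Hh , trans (cong (g ∙_) hL) gL

  A-inv : ∀ {g} → A g → A (g ⁻¹)
  A-inv {g} (Hg , gL) = hasInv g Hg , trans (cong (lnInv g) (sym gL)) (lnInvˡ g L)

  A-id : A (idA S)
  A-id = hasId , refl

  open Enumeration (pointsExcept p∈L) public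
    renaming (at to w; holds to w-holds; injective to w-injective; index to w-index)

  p≢x : p ≢ x
  p≢x refl = x∉L p∈L

  w∈L : ∀ i → w i ∈ L
  w∈L i = proj₁ (∖-elim (λ v → inc v L) (w-holds i))

  affine-on-L : ∀ {v} → v ∈ L → v ≢ p → Affine v
  affine-on-L v∈L v≢p x~v = v≢p (noTriangle x∉L v∈L p∈L x~v (onLine x∈N p∈N))

  w-affine : ∀ i → Affine (w i)
  w-affine i = affine-on-L (w∈L i) (proj₂ (∖-elim (λ v → inc v L) (w-holds i)))

  z : Point S
  z = w s₀

  z-affine : Affine z
  z-affine = w-affine s₀

  -- An affine line K meeting N in y is determined by y and one of its affine points.
  image-line : ∀ {h K M v y y′} → H h → Affine v → v ∈ K → y ∈ K → y ∈ N →
    h · v ∈ M → y′ ∈ M → y′ ∈ N → h ∙ K ≡ M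
  image-line {h} {K} {M} {v} {y} {y′} Hh aff v∈K y∈K y∈N hv∈M y′∈M y′∈N =
    twoPts (h · v) y′ (h ∙ K) M (λ { refl → affine∉ hv-affine x∈N y′∈N })
      (∈-map h v∈K) (subst (_∈ h ∙ K) hy≡y′ (∈-map h y∈K)) hv∈M y′∈M
    where
    hv-affine : Affine (h · v)
    hv-affine = affine-map Hh aff
    hy≡y′ : h · y ≡ y′
    hy≡y′ = noTriangle (affine∉ hv-affine x∈N) (∈x-map Hh x∈N y∈N) y′∈N
      (~-map h (onLine v∈K y∈K)) (onLine hv∈M y′∈M)

  abstract
    -- An element of `A` is determined by the image of `z`, which can be any of the `s` affine
    -- points of `L`. So these elements list `A` without repetition.
    a : Fin s → Aut S
    a i = proj₁ (transitive z (w i) z-affine (w-affine i))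

    a-H : ∀ i → H (a i)
    a-H i = proj₁ (proj₂ (transitive z (w i) z-affine (w-affine i)))

    a-z : ∀ i → a i · z ≡ w i
    a-z i = proj₂ (proj₂ (transitive z (w i) z-affine (w-affine i)))

  a-A : ∀ i → A (a i)
  a-A i = a-H i , image-line (a-H i) z-affine (w∈L s₀) p∈L p∈N
    (subst (_∈ L) (sym (a-z i)) (w∈L i)) p∈L p∈N

  A-index : ∀ {g} → A g → Σ (Fin s) λ i → a i ≐ g
  A-index {g} (Hg , gL) = proj₁ found , sharp z (a (proj₁ found)) g z-affine (a-H _) Hg (trans (a-z _) (proj₂ found))
    where
    found : Σ (Fin s) λ i → w i ≡ g · z
    found = w-index (g · z) (∖-intro (λ v → inc v L) (subst (g · z ∈_) gL (∈-map g (w∈L s₀)))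
      (λ e → affine-map Hg z-affine (subst (x ~_) (sym e) (onLine x∈N p∈N))))

  a-injective : ∀ {i j} → a i ≐ a j → i ≡ j
  a-injective {i} {j} e = w-injective i j (trans (sym (a-z i)) (trans (proj₁ e z) (a-z j)))

  A-fixesPoints : ∀ {g} → A g → FixesPoints N g
  A-fixesPoints {g} (Hg , gL) = fixesOne⇒fixesPoints Hg x∈N p∈N p≢x
    (noTriangle x∉L (subst (g · p ∈_) gL (∈-map g p∈L)) p∈L (~x-map Hg (onLine x∈N p∈N)) (onLine x∈N p∈N))

  -- The order of A is a power of the exponent of A

  q : ℕ
  q = proj₁ (proj₂ elementary)

  prod : List (Fin s) → Aut S
  prod []      = idA S
  prod (c ∷ v) = a c ∘ᴬ prod v

  prod-A : ∀ v → A (prod v)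
  prod-A []      = A-id
  prod-A (c ∷ v) = A-comp (a-A c) (prod-A v)

  prod-∷ʳ : ∀ v c y → prod (v ++ [ c ]) · y ≡ prod v · a c · y
  prod-∷ʳ []      c y = refl
  prod-∷ʳ (d ∷ v) c y = cong (a d ·_) (prod-∷ʳ v c y)

  prod-replicate : ∀ n c y → prod (replicate n c) · y ≡ iter (a c ·_) n y
  prod-replicate zero    c y = refl
  prod-replicate (suc n) c y = cong (a c ·_) (prod-replicate n c y)

  powA-iter : ∀ n g y → powA S g n · y ≡ iter (g ·_) n y
  powA-iter zero    g y = refl
  powA-iter (suc n) g y = cong (g ·_) (powA-iter n g y)

  -- Testing the product at the affine point `z` is decidable, and by sharpness it decides whether
  -- the product is the identity.
  trivial : List (Fin s) → Bool
  trivial v = does (prod v · z Fin.≟ z)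

  trivial-rot : ∀ v → trivial (rot v) ≡ trivial v
  trivial-rot []      = refl
  trivial-rot (c ∷ v) = cong (λ y → does (y Fin.≟ z))
    (trans (prod-∷ʳ v c z) (proj₁ (A-commutes (prod-A v) (a-A c)) z))

  trivial-complete : ∀ v → Σ (Fin s) λ c → trivial (c ∷ v) ≡ true × (∀ d → trivial (d ∷ v) ≡ true → d ≡ c)
  trivial-complete v with A-index (A-inv (prod-A v))
  ... | c , ac≐ = c , dec-true (a c · prod v · z Fin.≟ z) acv≡z , λ d e → a-injective
    (sharp (prod v · z) (a d) (a c) (affine-map (proj₁ (prod-A v)) z-affine) (a-H d) (a-H c)
      (trans (does⇒ (a d · prod v · z Fin.≟ z) e) (sym acv≡z)))
    where
    acv≡z : a c · prod v · z ≡ z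
    acv≡z = trans (proj₁ ac≐ (prod v · z)) (ptInvˡ (prod v) z)

  iter-id : ∀ {g} → g ≐ idA S → ∀ n y → iter (g ·_) n y ≡ y
  iter-id g≐1 zero    y = refl
  iter-id {g} g≐1 (suc n) y = trans (cong (g ·_) (iter-id {g} g≐1 n y)) (proj₁ g≐1 y)

  fixesZ⇒≐id : ∀ {g} → A g → g · z ≡ z → g ≐ idA S
  fixesZ⇒≐id {g} Ag = sharp z g (idA S) z-affine (proj₁ Ag) hasId

  coprime-exponents : ∀ {m} → Coprime m q → ∀ c → prod (replicate m c) · z ≡ z → a c ≐ idA S
  coprime-exponents {m} coprime c e = fixesZ⇒≐id (a-A c) (iter-coprime (a c ·_) coprime z
    (trans (sym (prod-replicate m c z)) e)
    (trans (sym (powA-iter q (a c) z)) (proj₁ (proj₂ (proj₂ (proj₂ elementary)) (a c) (a-A c)) z)))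

  -- Otherwise Cauchy's theorem gives a nonidentity element annihilated by the coprime exponents `ℓ`
  -- and `q`.
  prime∣s⇒≡q : ∀ ℓ → Prime ℓ → ℓ ∣ s → ℓ ≡ q
  prime∣s⇒≡q ℓ pr ℓ∣s with ℓ ≟ q
  ... | yes ℓ≡q = ℓ≡q
  ... | no ℓ≢q  = contradiction found λ { (c , c≢c₀ , e) → c≢c₀ (a-injective {c} {c₀}
      (≐-trans {a c} {idA S} {a c₀} (coprime-exponents
        (distinctPrimes⇒coprime pr (proj₁ (proj₂ (proj₂ elementary))) ℓ≢q) c (does⇒ (prod (replicate ℓ c) · z Fin.≟ z) e))
        (≐-sym {a c₀} {idA S} a-c₀))) }
    where
    c₀ : Fin s
    c₀ = proj₁ (A-index A-id)
    a-c₀ : a c₀ ≐ idA S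
    a-c₀ = proj₂ (A-index A-id)
    found : Σ (Fin s) λ c → c ≢ c₀ × trivial (replicate ℓ c) ≡ true
    found = cauchy pr trivial trivial-rot trivial-complete ℓ∣s c₀
      (dec-true (prod (replicate ℓ c₀) · z Fin.≟ z) (trans (prod-replicate ℓ c₀ z) (iter-id {a c₀} a-c₀ ℓ z)))

  -- The affine lines meeting N

  open Enumeration (pointsExcept x∈N) public
    renaming (at to Y; holds to Y-holds; injective to Y-injective; index to Y-index)

  Y∈N : ∀ i → Y i ∈ N
  Y∈N i = proj₁ (∖-elim (λ v → inc v N) (Y-holds i))

  Y≢x : ∀ i → Y i ≢ x
  Y≢x i = proj₂ (∖-elim (λ v → inc v N) (Y-holds i))

  module Through i = Enumeration (linesExcept (Y∈N i))

  M : Fin s → Fin t → Line S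
  M i = Through.at i

  Y∈M : ∀ i j → Y i ∈ M i j
  Y∈M i j = proj₁ (∖-elim (inc (Y i)) (Through.holds i j))

  x∉M : ∀ i j → x ∉ M i j
  x∉M i j x∈M = Y≢x i (meetAtX x∈M x∈N (proj₂ (∖-elim (inc (Y i)) (Through.holds i j))) (Y∈M i j) (Y∈N i))

  M-indexAt : ∀ i {K} → x ∉ K → Y i ∈ K → Σ (Fin t) λ j → M i j ≡ K
  M-indexAt i {K} x∉K Y∈K = Through.index i K (∖-intro (inc (Y i)) Y∈K (λ { refl → x∉K x∈N }))

  M-index : ∀ {K y} → x ∉ K → y ∈ K → y ∈ N → Σ (Fin s) λ i → Σ (Fin t) λ j → M i j ≡ K
  M-index {K} {y} x∉K y∈K y∈N with Y-index y (∖-intro (λ v → inc v N) y∈N (λ { refl → x∉K y∈K }))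
  ... | i , refl = i , M-indexAt i x∉K y∈K

  M-injective : ∀ {i i′ j j′} → M i j ≡ M i′ j′ → (i , j) ≡ (i′ , j′)
  M-injective {i} {i′} {j} {j′} e with Y-injective i i′ (noTriangle (x∉M i j) (Y∈M i j)
      (subst (Y i′ ∈_) (sym e) (Y∈M i′ j′)) (onLine x∈N (Y∈N i)) (onLine x∈N (Y∈N i′)))
  ... | refl with Through.injective i j j′ e
  ...   | refl = refl

  Λ : Fin (s * t) → Line S
  Λ u = M (proj₁ (remQuot {s} t u)) (proj₂ (remQuot {s} t u))

  Λ-injective : ∀ u v → Λ u ≡ Λ v → u ≡ v
  Λ-injective u v e = trans (sym (Fin.combine-remQuot {s} t u))
    (trans (cong (λ (i , j) → combine i j) (M-injective {proj₁ (remQuot {s} t u)} {proj₁ (remQuot {s} t v)} e))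
           (Fin.combine-remQuot {s} t v))

  Λ-combine : ∀ i j → Λ (combine i j) ≡ M i j
  Λ-combine i j = cong (λ (k , l) → M k l) (Fin.remQuot-combine {s} {t} i j)

  Λ-index : ∀ {K y} → x ∉ K → y ∈ K → y ∈ N → Σ (Fin (s * t)) λ u → Λ u ≡ K
  Λ-index x∉K y∈K y∈N with M-index x∉K y∈K y∈N
  ... | i , j , e = combine i j , trans (Λ-combine i j) e

  x∉Λ : ∀ u → x ∉ Λ u
  x∉Λ u = x∉M _ _

  fixes : Aut S → Line S → Bool
  fixes g K = does (g ∙ K Fin.≟ K)

  fixedΛ : Aut S → ℕ
  fixedΛ g = ∑[ u < s * t ] ι (fixes g (Λ u))

  -- As `h` fixes `N`, it permutes the affine lines meeting `N`, and it takes those fixed by `g` to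
  -- lines fixed by `g′`.
  fixedΛ-conj : ∀ {g g′ h} → H h → g′ ∘ᴬ h ≐ h ∘ᴬ g → fixedΛ g ≤ fixedΛ g′
  fixedΛ-conj {g} {g′} {h} Hh conj = ≤-trans (∑-mono (λ u → ι-mono (transport u)))
    (∑-injective φ (λ u → ι (fixes g′ (Λ u))) φ-injective)
    where
    index : ∀ u → Σ (Fin (s * t)) λ v → Λ v ≡ h ∙ Λ u
    index u = Λ-index (x∉-map Hh (x∉Λ u)) (∈-map h (Y∈M _ _)) (∈x-map Hh x∈N (Y∈N _))
    φ : Fin (s * t) → Fin (s * t)
    φ u = proj₁ (index u)
    φ-injective : ∀ u v → φ u ≡ φ v → u ≡ v
    φ-injective u v e = Λ-injective u v (∙-injective h (trans (sym (proj₂ (index u))) (trans (cong Λ e) (proj₂ (index v)))))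
    transport : ∀ u → fixes g (Λ u) ≡ true → fixes g′ (Λ (φ u)) ≡ true
    transport u e = dec-true (_ Fin.≟ _) (begin
      g′ ∙ Λ (φ u)  ≡⟨ cong (g′ ∙_) (proj₂ (index u)) ⟩
      g′ ∙ h ∙ Λ u  ≡⟨ proj₂ conj (Λ u) ⟩
      h ∙ g ∙ Λ u   ≡⟨ cong (h ∙_) (does⇒ (_ Fin.≟ _) e) ⟩
      h ∙ Λ u       ≡⟨ proj₂ (index u) ⟨
      Λ (φ u)       ∎)
      where open ≡-Reasoning

  module _ (t<s : t < s) {ℓ : ℕ} (prime : Prime ℓ) (ℓ∣s+t : ℓ ∣ s + t) (ℓ∤s : ¬ (ℓ ∣ s)) where

    private
      σ : Fin t → Aut S
      σ = proj₁ syms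
      Hσ : ∀ i → H (σ i)
      Hσ = proj₁ (proj₂ syms)
      σ-sym : ∀ i → Symmetry (σ i)
      σ-sym = proj₁ (proj₂ (proj₂ syms))

    open FixedLines S s t x H gq thick egq syms star prime ℓ∣s+t ℓ∤s

    -- A fixed affine line h L of aσ exhibits aσ as the conjugate of a under h.
    conjugate : ∀ {g} → A g → ¬ (g ≐ idA S) → ∀ i →
      Σ (Aut S) λ h → H h × (g ∘ᴬ σ i) ∘ᴬ h ≐ h ∘ᴬ g
    conjugate {g} Ag@(Hg , gL) g≢1 i = fromLine (fixedLine z-affine x∈N Hgσ fixN ¬sym)
      where
      Hgσ : H (g ∘ᴬ σ i)
      Hgσ = hasComp g (σ i) Hg (Hσ i)
      fixN : FixesPoints N (g ∘ᴬ σ i)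
      fixN y y∈N = trans (cong (g ·_) (σ-sym i y (onLine x∈N y∈N))) (A-fixesPoints Ag y y∈N)
      -- If the product were a symmetry, so would be `g`; since `g` fixes the affine line `L`, it
      -- would be the identity.
      ¬sym : ¬ Symmetry (g ∘ᴬ σ i)
      ¬sym gσ-sym = g≢1 (agree⇒≐ Hg hasId
        (λ y x~y → trans (cong (g ·_) (sym (σ-sym i y x~y))) (gσ-sym y x~y)) x∉L gL)
      -- On the points collinear with `x` the symmetry is trivial and `g` commutes with `h`;
      -- moreover both products send `L` to `K`.
      carried : ∀ {h K} → H h → h ∙ L ≡ K → g ∙ σ i ∙ K ≡ K → (g ∘ᴬ σ i) ∘ᴬ h ≐ h ∘ᴬ g
      carried {h} {K} Hh hL≡K fix = agree⇒≐ (hasComp (g ∘ᴬ σ i) h Hgσ Hh) (hasComp h g Hh Hg)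
        (λ u x~u → trans (cong (g ·_) (σ-sym i (h · u) (~x-map Hh x~u)))
                         (commuteNearX z-affine x∈N Hg Hh (A-fixesPoints Ag) u x~u))
        x∉L
        (trans (cong (λ Q → g ∙ σ i ∙ Q) hL≡K) (trans fix (trans (sym hL≡K) (cong (h ∙_) (sym gL)))))
      fromLine : (Σ (Line S) λ K → x ∉ K × g ∙ σ i ∙ K ≡ K × Σ (Point S) λ y → y ∈ K × y ∈ N × y ≢ x) →
                 Σ (Aut S) λ h → H h × (g ∘ᴬ σ i) ∘ᴬ h ≐ h ∘ᴬ g
      fromLine (K , x∉K , fix , y , y∈K , y∈N , _) =
        let v , v∈K , v-affine = affinePoint x∉K
            h , Hh , hz≡v = transitive z v z-affine v-affine
        in h , Hh , carried Hh (image-line Hh z-affine (w∈L s₀) p∈L p∈N (subst (_∈ K) (sym hz≡v) v∈K) y∈K y∈N) fix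

    -- Each of the `t` products `g ∘ᴬ σ i` is conjugate to `g`, so it fixes at least as many lines.
    -- No line is fixed by two of them, and there are `s * t` lines.
    fixedΛ≤s : ∀ {g} → A g → ¬ (g ≐ idA S) → fixedΛ g ≤ s
    fixedΛ≤s {g} Ag@(Hg , gL) g≢1 = *-cancelˡ-≤ t {{>-nonZero 0<t}} (begin
      t * fixedΛ g                                              ≡⟨ ∑-const t (fixedΛ g) ⟨
      ∑[ i < t ] fixedΛ g
        ≤⟨ ∑-mono (λ i → let h , Hh , conj = conjugate Ag g≢1 i in fixedΛ-conj {g} {g ∘ᴬ σ i} {h} Hh conj) ⟩
      ∑[ i < t ] ∑[ u < s * t ] ι (fixes (g ∘ᴬ σ i) (Λ u))
        ≡⟨ ∑-comm (λ i u → ι (fixes (g ∘ᴬ σ i) (Λ u))) ⟩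
      ∑[ u < s * t ] ∑[ i < t ] ι (fixes (g ∘ᴬ σ i) (Λ u))
        ≤⟨ ∑-mono (λ u → ∑ι-atMost (λ i → fixes (g ∘ᴬ σ i) (Λ u))
          (λ i j ei ej → unique u i j (does⇒ (_ Fin.≟ _) ei) (does⇒ (_ Fin.≟ _) ej))) ⟩
      ∑[ u < s * t ] 1                                          ≡⟨ ∑-const (s * t) 1 ⟩
      s * t * 1
        ≡⟨ trans (*-identityʳ (s * t)) (*-comm s t) ⟩
      t * s                                                     ∎)
      where
      open ≤-Reasoning
      unique : ∀ u i j → g ∙ σ i ∙ Λ u ≡ Λ u → g ∙ σ j ∙ Λ u ≡ Λ u → i ≡ j
      unique u i j ei ej with i Fin.≟ j
      ... | yes i≡j = i≡j
      ... | no i≢j  = contradiction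
        (agree⇒≐ (Hσ i) (Hσ j) (λ y x~y → trans (σ-sym i y x~y) (sym (σ-sym j y x~y))) (x∉Λ u)
          (∙-injective g (trans ei (sym ej))))
        (proj₁ (proj₂ (proj₂ (proj₂ syms))) i j i≢j)

    -- The identity is allotted `s` like every other element, and in addition the number `s * t` of
    -- all lines.
    ∑fixedΛ≤ : ∑[ k < s ] fixedΛ (a k) ≤ s * s + s * t
    ∑fixedΛ≤ = begin
      ∑[ k < s ] fixedΛ (a k)                                        ≤⟨ ∑-mono bound ⟩
      ∑[ k < s ] (s + s * t * ι (does (k Fin.≟ c₀)))
        ≡⟨ ∑-distrib-+ (λ _ → s) (λ k → s * t * ι (does (k Fin.≟ c₀))) ⟩
      ∑[ k < s ] s + ∑[ k < s ] (s * t * ι (does (k Fin.≟ c₀)))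
        ≡⟨ cong₂ _+_ (∑-const s s) (trans (sym (*-distribˡ-sum (s * t) (λ k → ι (does (k Fin.≟ c₀)))))
          (trans (cong (s * t *_) (∑ι-≟ c₀)) (*-identityʳ (s * t)))) ⟩
      s * s + s * t                                                  ∎
      where
      open ≤-Reasoning
      c₀ : Fin s
      c₀ = proj₁ (A-index A-id)
      bound : ∀ k → fixedΛ (a k) ≤ s + s * t * ι (does (k Fin.≟ c₀))
      bound k with k Fin.≟ c₀
      ... | no k≢c₀ = ≤-trans (fixedΛ≤s (a-A k) (λ e → k≢c₀ (a-injective
          (≐-trans {a k} {idA S} {a c₀} e (≐-sym {a c₀} {idA S} (proj₂ (A-index A-id)))))))
                        (m≤m+n s _)
      ... | yes _   = ≤-trans (∑-mono {g = λ _ → 1} (λ u → ι≤1 (fixes (a k) (Λ u))))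
                        (≤-trans (≤-reflexive (∑-const (s * t) 1)) (m≤n+m (s * t * 1) s))
        where
        ι≤1 : ∀ c → ι c ≤ 1
        ι≤1 true  = ≤-refl
        ι≤1 false = z≤n

    -- Orbits of A on the affine lines through a point of N

    module Orbit (i : Fin s) where

      moving : Line S → Fin t → ℕ
      moving K j = ∑[ k < s ] ι (does (a k ∙ K Fin.≟ M i j))

      stabilizer : Fin t → ℕ
      stabilizer j = ∑[ k < s ] ι (fixes (a k) (M i j))

      ∑-moving : ∀ {K} → x ∉ K → Y i ∈ K → ∑[ j < t ] moving K j ≡ s
      ∑-moving {K} x∉K Y∈K = begin
        ∑[ j < t ] ∑[ k < s ] ι (does (a k ∙ K Fin.≟ M i j))
          ≡⟨ ∑-comm (λ j k → ι (does (a k ∙ K Fin.≟ M i j))) ⟩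
        ∑[ k < s ] ∑[ j < t ] ι (does (a k ∙ K Fin.≟ M i j))  ≡⟨ sum-cong-≗ one ⟩
        ∑[ k < s ] 1                                          ≡⟨ trans (∑-const s 1) (*-identityʳ s) ⟩
        s                                                     ∎
        where
        open ≡-Reasoning
        one : ∀ k → ∑[ j < t ] ι (does (a k ∙ K Fin.≟ M i j)) ≡ 1
        one k with M-indexAt i (x∉-map (a-H k) x∉K)
                     (subst (_∈ a k ∙ K) (A-fixesPoints (a-A k) (Y i) (Y∈N i)) (∈-map (a k) Y∈K))
        ... | j , e = ∑ι-unique (λ j → does (a k ∙ K Fin.≟ M i j)) j (dec-true (_ Fin.≟ _) (sym e))
          (λ l el → Through.injective i l j (trans (sym (does⇒ (_ Fin.≟ _) el)) (sym e)))

      -- Right multiplication by the inverse of `a k₀` takes the elements that carry `K` to `M i j`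
      -- injectively into the stabilizer of `M i j`.
      moving≤stabilizer : ∀ {K k₀} j → a k₀ ∙ K ≡ M i j → moving K j ≤ stabilizer j
      moving≤stabilizer {K} {k₀} j e₀ = ≤-trans (∑-mono (λ k → ι-mono (transport k)))
        (∑-injective φ (λ k → ι (fixes (a k) (M i j))) φ-injective)
        where
        index : ∀ k → Σ (Fin s) λ l → a l ≐ a k ∘ᴬ a k₀ ⁻¹
        index k = A-index (A-comp (a-A k) (A-inv (a-A k₀)))
        φ : Fin s → Fin s
        φ k = proj₁ (index k)
        φ-injective : ∀ k l → φ k ≡ φ l → k ≡ l
        φ-injective k l e = w-injective k l (trans (sym (image k)) (trans (cong (λ f → a f · a k₀ · z) e) (image l)))
          where
          image : ∀ k → a (φ k) · a k₀ · z ≡ w k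
          image k = trans (proj₁ (proj₂ (index k)) (a k₀ · z)) (trans (cong (a k ·_) (ptInvˡ (a k₀) z)) (a-z k))
        transport : ∀ k → does (a k ∙ K Fin.≟ M i j) ≡ true → fixes (a (φ k)) (M i j) ≡ true
        transport k e = dec-true (_ Fin.≟ _) (begin
          a (φ k) ∙ M i j             ≡⟨ proj₂ (proj₂ (index k)) (M i j) ⟩
          a k ∙ lnInv (a k₀) (M i j)  ≡⟨ cong (λ Q → a k ∙ lnInv (a k₀) Q) e₀ ⟨
          a k ∙ lnInv (a k₀) (a k₀ ∙ K) ≡⟨ cong (a k ∙_) (lnInvˡ (a k₀) K) ⟩
          a k ∙ K                     ≡⟨ does⇒ (_ Fin.≟ _) e ⟩
          M i j                       ∎)
          where open ≡-Reasoning

      -- Each of `K` and `K′` spreads a total of `s` over its own orbit. The orbits are disjoint, so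
      -- at each line at most one of the two terms is nonzero and the stabilizer bounds it.
      twoOrbits : ∀ {K K′} → x ∉ K → x ∉ K′ → Y i ∈ K → Y i ∈ K′ → (∀ k → a k ∙ K ≢ K′) →
                  s + s ≤ ∑[ j < t ] stabilizer j
      twoOrbits {K} {K′} x∉K x∉K′ Y∈K Y∈K′ apart = begin
        s + s
          ≡⟨ cong₂ _+_ (∑-moving x∉K Y∈K) (∑-moving x∉K′ Y∈K′) ⟨
        ∑[ j < t ] moving K j + ∑[ j < t ] moving K′ j      ≡⟨ ∑-distrib-+ (moving K) (moving K′) ⟨
        ∑[ j < t ] (moving K j + moving K′ j)               ≤⟨ ∑-mono both ⟩
        ∑[ j < t ] stabilizer j                             ∎
        where
        open ≤-Reasoning
        both : ∀ j → moving K j + moving K′ j ≤ stabilizer j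
        both j with ∑ι-find (λ k → does (a k ∙ K Fin.≟ M i j)) | ∑ι-find (λ k → does (a k ∙ K′ Fin.≟ M i j))
        ... | inj₁ none | inj₁ none′ rewrite none | none′ = z≤n
        ... | inj₁ none | inj₂ (k , e) rewrite none = moving≤stabilizer {K′} {k} j (does⇒ (_ Fin.≟ _) e)
        ... | inj₂ (k , e) | inj₁ none rewrite none =
          ≤-trans (≤-reflexive (+-identityʳ _)) (moving≤stabilizer {K} {k} j (does⇒ (_ Fin.≟ _) e))
        ... | inj₂ (k , e) | inj₂ (k′ , e′) with A-index (A-comp (A-inv (a-A k′)) (a-A k))
        ...   | l , al≐ = contradiction (trans (proj₂ al≐ K)
          (trans (cong (lnInv (a k′)) (trans (does⇒ (_ Fin.≟ _) e) (sym (does⇒ (_ Fin.≟ _) e′)))) (lnInvˡ (a k′) K′))) (apart l)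

      Transitive : Set
      Transitive = ∀ j → Σ (Fin s) λ k → a k ∙ M i t₀ ≡ M i j

      reaches? : ∀ j → Dec (Σ (Fin s) λ k → a k ∙ M i t₀ ≡ M i j)
      reaches? j = Fin.any? (λ k → a k ∙ M i t₀ Fin.≟ M i j)

      transitive? : Dec Transitive
      transitive? = Fin.all? reaches?

      intransitive : ¬ Transitive → s + s ≤ ∑[ j < t ] stabilizer j
      intransitive ¬trans with Fin.¬∀⟶∃¬ t _ reaches? ¬trans
      ... | j , unreached = twoOrbits (x∉M i t₀) (x∉M i j) (Y∈M i t₀) (Y∈M i j) (λ k e → unreached (k , e))

    -- Burnside's double count of the pairs of an element of `A` and a line fixed by it.
    ∑stabilizers : ∑[ i < s ] ∑[ j < t ] Orbit.stabilizer i j ≡ ∑[ k < s ] fixedΛ (a k)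
    ∑stabilizers = begin
      ∑[ i < s ] ∑[ j < t ] ∑[ k < s ] ι (fixes (a k) (M i j))
        ≡⟨ sum-cong-≗ (λ i → sum-cong-≗ (λ j → sum-cong-≗ (λ k → cong (λ K → ι (fixes (a k) K)) (sym (Λ-combine i j))))) ⟩
      ∑[ i < s ] ∑[ j < t ] ∑[ k < s ] ι (fixes (a k) (Λ (combine i j)))
        ≡⟨ ∑-combine s t (λ u → ∑[ k < s ] ι (fixes (a k) (Λ u))) ⟨
      ∑[ u < s * t ] ∑[ k < s ] ι (fixes (a k) (Λ u))
        ≡⟨ ∑-comm (λ u k → ι (fixes (a k) (Λ u))) ⟩
      ∑[ k < s ] fixedΛ (a k) ∎
      where open ≡-Reasoning

    someTransitive : Σ (Fin s) λ i → Orbit.Transitive i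
    someTransitive with Fin.any? Orbit.transitive?
    ... | yes found = found
    ... | no none = contradiction t<s (≤⇒≯ s≤t)
      where
      s≤t : s ≤ t
      s≤t = *-cancelˡ-≤ s {{>-nonZero 0<s}} (+-cancelˡ-≤ (s * s) _ _ (begin
        s * s + s * s                                  ≡⟨ *-distribˡ-+ s s s ⟨
        s * (s + s)                                    ≡⟨ ∑-const s (s + s) ⟨
        ∑[ i < s ] (s + s)
          ≤⟨ ∑-mono (λ i → Orbit.intransitive i (λ tr → none (i , tr))) ⟩
        ∑[ i < s ] ∑[ j < t ] Orbit.stabilizer i j     ≡⟨ ∑stabilizers ⟩
        ∑[ k < s ] fixedΛ (a k)                        ≤⟨ ∑fixedΛ≤ ⟩
        s * s + s * t                                  ∎))
        where open ≤-Reasoning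

    -- Root-elations from a transitive action

    module _ (i : Fin s) (trans-i : Orbit.Transitive i) where

      -- `A` is abelian, so `g` commutes with the element of `A` that carries the base line to
      -- `M i j`.
      fixesBase⇒fixesAll : ∀ {g} → A g → g ∙ M i t₀ ≡ M i t₀ → ∀ j → g ∙ M i j ≡ M i j
      fixesBase⇒fixesAll {g} Ag fix j with trans-i j
      ... | k , e = trans (cong (g ∙_) (sym e))
        (trans (proj₂ (A-commutes Ag (a-A k)) (M i t₀)) (trans (cong (a k ∙_) fix) e))

      fixesOne⇒fixesBase : ∀ {g} → A g → ∀ j → g ∙ M i j ≡ M i j → g ∙ M i t₀ ≡ M i t₀
      fixesOne⇒fixesBase {g} Ag j fix with trans-i j
      ... | k , e = ∙-injective (a k) (trans (sym (proj₂ (A-commutes Ag (a-A k)) (M i t₀)))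
        (trans (cong (g ∙_) e) (trans fix (sym e))))

      -- If g fixes every line through Y i, then gσ and σg agree on such lines.
      fixesThroughP : ∀ {g} → A g → g ∙ M i t₀ ≡ M i t₀ → FixesLinesThrough S p g
      fixesThroughP {g} Ag@(Hg , gL) fix K p∈K with inc x K Bool.≟ true
      ... | yes x∈K = fixLines g Hg K x∈K
      -- `K` is the image of `L` under a symmetry `τ`. Once `g` commutes with `τ`, it fixes `K`
      -- because it fixes `L`.
      ... | no x∉K with symmetry-between (onLine x∈N p∈N) p≢x x∉L x∉K p∈L p∈K
      ...   | τ , Hτ , τ-sym , refl = trans (proj₂ commute L) (cong (τ ∙_) gL)
        where
        τM∋Y : Y i ∈ τ ∙ M i t₀
        τM∋Y = subst (_∈ τ ∙ M i t₀) (τ-sym (Y i) (onLine x∈N (Y∈N i))) (∈-map τ (Y∈M i t₀))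
        gτM : g ∙ τ ∙ M i t₀ ≡ τ ∙ M i t₀
        gτM with M-indexAt i (x∉-map Hτ (x∉M i t₀)) τM∋Y
        ... | j , e = subst (λ Q → g ∙ Q ≡ Q) e (fixesBase⇒fixesAll Ag fix j)
        commute : g ∘ᴬ τ ≐ τ ∘ᴬ g
        commute = agree⇒≐ (hasComp g τ Hg Hτ) (hasComp τ g Hτ Hg)
          (λ y x~y → trans (cong (g ·_) (τ-sym y x~y)) (sym (τ-sym (g · y) (~x-map Hg x~y))))
          (x∉M i t₀) (trans gτM (cong (τ ∙_) (sym fix)))

      open Orbit i

      -- The `s` elements of `A` spread the base line over `t` lines. Each line receives at most as
      -- many as its stabilizer has, and that stabilizer also fixes the base line.
      s≤stabilizer*t : s ≤ stabilizer t₀ * t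
      s≤stabilizer*t = begin
        s                                    ≡⟨ ∑-moving (x∉M i t₀) (Y∈M i t₀) ⟨
        ∑[ j < t ] moving (M i t₀) j         ≤⟨ ∑-mono bound ⟩
        ∑[ j < t ] stabilizer t₀             ≡⟨ ∑-const t (stabilizer t₀) ⟩
        t * stabilizer t₀                    ≡⟨ *-comm t (stabilizer t₀) ⟩
        stabilizer t₀ * t                    ∎
        where
        open ≤-Reasoning
        bound : ∀ j → moving (M i t₀) j ≤ stabilizer t₀
        bound j = ≤-trans (moving≤stabilizer {k₀ = proj₁ (trans-i j)} j (proj₂ (trans-i j)))
          (∑-mono (λ k → ι-mono (λ e → dec-true (_ Fin.≟ _)
            (fixesOne⇒fixesBase (a-A k) j (does⇒ (_ Fin.≟ _) e)))))

    rootElations : Σ ℕ λ k → s ≤ k * t × Σ (Fin k → Aut S) λ f →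
      (∀ i j → i ≢ j → ¬ (f i ≐ f j)) × (∀ i → A (f i)) × (∀ i → FixesLinesThrough S p (f i))
    rootElations with someTransitive
    ... | i , tr = Orbit.stabilizer i t₀ , s≤stabilizer*t i tr , (λ k → a (at k)) ,
          (λ k l k≢l e → k≢l (injective k l (a-injective e))) , (λ k → a-A (at k)) ,
          (λ k → fixesThroughP i tr (a-A (at k)) (does⇒ (_ Fin.≟ _) (holds k)))
      where open Enumeration (enumerate (λ k → fixes (a k) (M i t₀)))

mainTheorem10 : (S : IncStr) (s t : ℕ) (x : Point S) (H : Aut S → Set) →
    IsGQ S s t → Thick S s t →
    IsEGQ S x H → HasSymGroup S t x H → PropStar S x H →
    (2 ∣ s → s ≢ t) →
    (∀ L → ¬ (_I_ S x L) → ElemAbelian S (Stab S H L)) →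
    ∀ L → ¬ (_I_ S x L) →
    ∀ p → _I_ S p L → Collinear S x p →
    Σ ℕ λ k → s ≤ k * t ×
    Σ (Fin k → Aut S) λ f →
    (∀ i j → i ≢ j → ¬ (_≈A_ S (f i) (f j))) ×
    (∀ i → Stab S H L (f i)) ×
    (∀ i → FixesLinesThrough S p (f i))
mainTheorem10 S s t x H gq thick egq syms star _ elementary L x∉L p p∈L (N , x∈N , p∈N) with t <? s
... | yes t<s =
  let open LineStabilizer S s t x H gq thick egq syms star L x∉L (elementary L x∉L) p p∈L N x∈N p∈N
      -- A prime divisor of `s + t` not dividing `s` exists because `t < s` and `s` has no prime
      -- divisor except `q`.
      _ , pr , ℓ∣s+t , ℓ∤s = primeDivisor-+ s t q (≤-trans (s≤s z≤n) (proj₂ thick)) t<s prime∣s⇒≡q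
  in rootElations t<s pr ℓ∣s+t ℓ∤s
-- If `s` is at most `t`, the identity alone suffices, with `k` equal to 1.
... | no t≮s  = 1 , ≤-trans (≮⇒≥ t≮s) (≤-reflexive (sym (*-identityˡ t))) , (λ _ → idA S) ,
  (λ { zero zero 0≢0 → contradiction refl 0≢0 }) ,
  (λ _ → IsSubgroup.hasId (IsEGQ.subgroup egq) , refl) , (λ _ _ _ → refl)
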